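{- Let $t$ be a positive integer. If $G$ is an induced-subgraph-minimal graph having a pivot-minor isomorphic to $P_3+tP_1$, then $|V(G)|\le (t+1)(2^{t+3}-t-4)+2$.
   Context: Graphs are finite, without loops or multiple edges. $P_3+tP_1$ is the disjoint union of the path on three vertices and $t$ isolated vertices. For a vertex $u$ of a graph $G$, the local complementation $G*u$ is obtained from $G$ by complementing the adjacency between every pair of distinct neighbours of $u$. For an edge $uv$ of $G$, the edge pivot is $G\wedge uv=((G*u)*v)*u$. A graph $G$ contains $H$ as a pivot-minor if $H$ can be obtained from $G$ by a sequence of vertex deletions and edge pivots. A graph $G$ is an induced-subgraph-minimal graph having a pivot-minor isomorphic to $H$ if $G$ has a pivot-minor isomorphic to $H$ but no proper induced subgraph of $G$ does. -}

module Defs where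

open import Data.Bool.Base using (Bool; true; false; not; _∧_; _∨_; _xor_)
open import Data.Bool.Properties using (∧-comm; ∧-zeroʳ; ∨-comm)
open import Data.Fin.Base using (Fin; zero; suc; toℕ; punchIn; splitAt)
open import Data.Fin.Properties using (_≟_)
open import Data.Fin.Subset using (Subset; inside; outside; ∣_∣; ⊤; _⊂_)
open import Data.Nat.Base using (ℕ; zero; suc; _+_; _≡ᵇ_)
open import Data.Product.Base using (Σ-syntax; ∃-syntax; _×_)
open import Data.Sum.Base using (inj₁; inj₂)
open import Data.Vec.Base using ([]; _∷_)
open import Function.Bundles using (_↔_; Inverse)
open import Relation.Binary.PropositionalEquality
  using (_≡_; refl; sym; cong; cong₂; trans)
open import Relation.Nullary.Decidable using (⌊_⌋; yes; no)
open import Relation.Nullary.Negation using (¬_; contradiction)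

-- A finite simple graph with n vertices; its vertex set is Fin n.
record Graph (n : ℕ) : Set where
  field
    adj     : Fin n → Fin n → Bool
    adj-sym : ∀ x y → adj x y ≡ adj y x
    adj-irr : ∀ x → adj x x ≡ false

open Graph public

Adjacent : ∀ {n} → Graph n → Fin n → Fin n → Set
Adjacent G x y = adj G x y ≡ true

infix 4 _≅_

_≅_ : ∀ {m n} → Graph m → Graph n → Set
_≅_ {m} {n} G H =
  Σ[ φ ∈ Fin m ↔ Fin n ]
    (∀ x y → adj G x y ≡ adj H (Inverse.to φ x) (Inverse.to φ y))

------------------------------------------------------------------------
-- Induced subgraphs

pullback : ∀ {m n} → Graph n → (Fin m → Fin n) → Graph m
pullback G f .adj     x y = adj G (f x) (f y)
pullback G f .adj-sym x y = adj-sym G (f x) (f y)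
pullback G f .adj-irr x   = adj-irr G (f x)

-- The increasing enumeration of the elements of S.
enum : ∀ {n} (S : Subset n) → Fin ∣ S ∣ → Fin n
enum (inside  ∷ S) zero    = zero
enum (inside  ∷ S) (suc i) = suc (enum S i)
enum (outside ∷ S) i       = suc (enum S i)

infix 8 _[_]

_[_] : ∀ {n} → Graph n → (S : Subset n) → Graph ∣ S ∣
G [ S ] = pullback G (enum S)

deleteVertex : ∀ {n} → Graph (suc n) → Fin (suc n) → Graph n
deleteVertex G v = pullback G (punchIn v)

------------------------------------------------------------------------
-- Local complementation and pivoting

distinct : ∀ {n} → Fin n → Fin n → Bool
distinct x y = not ⌊ x ≟ y ⌋

distinct-sym : ∀ {n} (x y : Fin n) → distinct x y ≡ distinct y x
distinct-sym x y with x ≟ y | y ≟ x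
... | yes _   | yes _   = refl
... | no  _   | no  _   = refl
... | yes x≡y | no  y≢x = contradiction (sym x≡y) y≢x
... | no  x≢y | yes y≡x = contradiction (sym y≡x) x≢y

distinct-irr : ∀ {n} (x : Fin n) → distinct x x ≡ false
distinct-irr x with x ≟ x
... | yes _   = refl
... | no  x≢x = contradiction refl x≢x

infixl 7 _*ˡ_

-- The xor flips exactly the pairs of distinct neighbours of u.
_*ˡ_ : ∀ {n} → Graph n → Fin n → Graph n
(G *ˡ u) .adj x y = adj G x y xor ((adj G u x ∧ adj G u y) ∧ distinct x y)
(G *ˡ u) .adj-sym x y =
  cong₂ _xor_ (adj-sym G x y)
    (cong₂ _∧_ (∧-comm (adj G u x) (adj G u y)) (distinct-sym x y))
(G *ˡ u) .adj-irr x =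
  cong₂ _xor_ (adj-irr G x)
    (trans (cong ((adj G u x ∧ adj G u x) ∧_) (distinct-irr x))
           (∧-zeroʳ (adj G u x ∧ adj G u x)))

pivot : ∀ {n} (G : Graph n) (u v : Fin n) → Adjacent G u v → Graph n
pivot G u v _ = ((G *ˡ u) *ˡ v) *ˡ u

infix 4 _⟶*_

data _⟶*_ {n} (G : Graph n) : ∀ {m} → Graph m → Set where
  done      : G ⟶* G
  thenDel   : ∀ {m} {H : Graph (suc m)} →
              G ⟶* H → (v : Fin (suc m)) → G ⟶* deleteVertex H v
  thenPivot : ∀ {m} {H : Graph m} →
              G ⟶* H → (u v : Fin m) (uv : Adjacent H u v) →
              G ⟶* pivot H u v uv

HasPivotMinor : ∀ {m n} → Graph n → Graph m → Set
HasPivotMinor G H = ∃[ k ] Σ[ H′ ∈ Graph k ] (G ⟶* H′ × H′ ≅ H)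

MinimalWithPivotMinor : ∀ {m n} → Graph n → Graph m → Set
MinimalWithPivotMinor {n = n} G H =
  HasPivotMinor G H ×
  (∀ (S : Subset n) → S ⊂ ⊤ → ¬ HasPivotMinor (G [ S ]) H)

------------------------------------------------------------------------
-- The graph P₃ + tP₁

path : ∀ n → Graph n
path n .adj x y = (suc (toℕ x) ≡ᵇ toℕ y) ∨ (suc (toℕ y) ≡ᵇ toℕ x)
path n .adj-sym x y = ∨-comm (suc (toℕ x) ≡ᵇ toℕ y) (suc (toℕ y) ≡ᵇ toℕ x)
path n .adj-irr x = cong₂ _∨_ (irr (toℕ x)) (irr (toℕ x))
  where
  irr : ∀ k → (suc k ≡ᵇ k) ≡ false
  irr zero    = refl
  irr (suc k) = irr k

edgeless : ∀ n → Graph n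
edgeless n .adj     _ _ = false
edgeless n .adj-sym _ _ = refl
edgeless n .adj-irr _   = refl

infixl 6 _⊔ᴳ_

_⊔ᴳ_ : ∀ {m n} → Graph m → Graph n → Graph (m + n)
_⊔ᴳ_ {m} G H .adj x y with splitAt m x | splitAt m y
... | inj₁ i | inj₁ j = adj G i j
... | inj₂ i | inj₂ j = adj H i j
... | inj₁ _ | inj₂ _ = false
... | inj₂ _ | inj₁ _ = false
_⊔ᴳ_ {m} G H .adj-sym x y with splitAt m x | splitAt m y
... | inj₁ i | inj₁ j = adj-sym G i j
... | inj₂ i | inj₂ j = adj-sym H i j
... | inj₁ _ | inj₂ _ = refl
... | inj₂ _ | inj₁ _ = refl
_⊔ᴳ_ {m} G H .adj-irr x with splitAt m x
... | inj₁ i = adj-irr G i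
... | inj₂ i = adj-irr H i

P₃+_P₁ : ∀ t → Graph (3 + t)
P₃+ t P₁ = path 3 ⊔ᴳ edgeless t

{-# OPTIONS --safe #-}
module Submission where

-- Some principal pivot transform A of G, on a vertex set X, has an induced copy a - b - c, I of
-- P₃ + tP₁, and minimality says that whenever such a pair (A , X) contains a copy, every vertex
-- off the copy lies in X.  As pivoting on u v flips u and v in X, no copy may
-- avoid u ∈ X after such a pivot.  This forbids t + 1 vertices off the copy with the same
-- neighbourhood N in it, unless N = {b}.
--
-- The vertices with N = {b} ("leaves") may be numerous, but they lie in X and are pairwise
-- nonadjacent, so nonsingularity of A on X makes them at most as many as the vertices with other
-- N.  Any two leaves can replace a and c, and a vertex having t + 1 neighbours among the leaves is
-- adjacent to all of them; hence, if there are more than (t + 1) t + 1 leaves, the other vertices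
-- fall into only 2^(t + 2) classes of size at most t instead of 2^(t + 3).

open import Defs
open import Algebra.Bundles using (CommutativeRing)
open import Data.Bool.Base using (Bool; true; false; not; _∧_; _∨_; _xor_)
import Data.Bool.Properties as Bool
open import Data.Bool.Properties
  using (xor-∧-commutativeRing; xor-same; xor-identityʳ; xor-assoc; ∧-zeroʳ; ∧-identityʳ; ∧-assoc; ∧-comm;
         ∧-distribˡ-xor; ∧-distribʳ-xor; ¬-not)
open import Data.Empty using (⊥; ⊥-elim)
open import Data.Fin.Base using (Fin; zero; suc; toℕ; inject≤; punchIn; punchOut; funToFin; finToFun)
open import Data.Fin.Patterns using (0F; 1F; 2F)
open import Data.Fin.Properties
  using (_≟_; any?; all?; suc-injective; toℕ<n; toℕ-injective; inject≤-injective; punchOut-injective;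
         punchIn-punchOut; punchIn-injective; pigeonhole; 2↔Bool; finToFun-funToFin; funToFin-finToFin; <⇒≢)
open import Data.Fin.Subset using (Subset; ⊤; _-_) renaming (_∈_ to _∈ₛ_)
open import Data.Fin.Subset.Properties using (x∈p⇒p-x⊂p; x∈p∧x≢y⇒x∈p-y; ∈⊤)
open import Data.List.Base using (List; []; _∷_; length; filter; lookup; allFin)
open import Data.List.Properties using (length-tabulate)
open import Data.List.Membership.Propositional using (_∈_; find)
open import Data.List.Membership.Propositional.Properties using (∈-lookup; ∈-filter⁺; ∈-filter⁻; ∈-allFin)
open import Data.List.Relation.Unary.All as All using (All)
open import Data.List.Relation.Unary.All.Properties using (¬All⇒Any¬)
open import Data.List.Relation.Unary.AllPairs using (_∷_)
open import Data.List.Relation.Unary.Any using (here; index)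
open import Data.List.Relation.Unary.Any.Properties using (lookup-index)
open import Data.List.Relation.Unary.Unique.Propositional using (Unique)
open import Data.List.Relation.Unary.Unique.Propositional.Properties
  using (filter⁺; allFin⁺; Unique[x∷xs]⇒x∉xs)
open import Data.Nat.Base using (ℕ; zero; suc; _+_; _*_; _∸_; _^_; _≤_; _<_; z≤n; s≤s)
import Data.Nat.Properties as ℕ
open import Data.Nat.Tactic.RingSolver using (solve-∀)
open import Data.Product.Base using (Σ-syntax; ∃-syntax; _×_; _,_; proj₁; proj₂)
open import Data.Vec.Base using (_∷_; here; there)
open import Function.Base using (_∘_; id)
open import Function.Bundles using (Inverse; mk↔ₛ′)
open import Function.Definitions using (Injective)
open import Relation.Binary.PropositionalEquality hiding ([_])
open import Relation.Nullary.Decidable using (Dec; yes; no; ⌊_⌋; ¬?; _×-dec_; decidable-stable)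
open import Relation.Nullary.Negation using (¬_; contradiction)
open import Relation.Unary using (Decidable)
open import Algebra.Properties.Semiring.Sum (CommutativeRing.semiring xor-∧-commutativeRing)
  using (sum; sum-cong-≗; ∑-distrib-+; *-distribˡ-sum; sum-replicate-zero)

-- Linear algebra over GF(2) and pivoting

-- Minimality concerns induced subgraphs of `G`, whereas the copy lives in `A`, reached by pivots
-- that may pass through vertices to be deleted. Remembering only `X` removes this obstacle: the
-- transform on `X` can be rebuilt by pivots inside `X`, hence in every induced subgraph of `G`
-- containing `X`. Each later argument therefore picks a pivot, finds a copy afterwards, and only
-- compares that copy with the new set. The neighbourhood of a leaf is exceptional because
-- exchanging `b` with the leaf merely shows that `b` lies outside `X`, which any number of leaves
-- tolerates. The same fact makes the rank argument work: within `X`, the columns of the leaves are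
-- supported on the other vertices off the copy. Bounding the leaves by those other vertices may
-- double the count; halving the number of classes pays for this.

Op : ℕ → Set
Op zero    = Bool
Op (suc k) = Bool → Op k

agree : ∀ k → Op k → Op k → Bool
agree zero    f g = not (f xor g)
agree (suc k) f g = agree k (f true) (g true) ∧ agree k (f false) (g false)

Equal : ∀ k → Op k → Op k → Set
Equal zero    f g = f ≡ g
Equal (suc k) f g = ∀ b → Equal k (f b) (g b)

∧-true : ∀ {x y} → x ∧ y ≡ true → x ≡ true × y ≡ true
∧-true {true} {true} _ = refl , refl

-- Proof by reflection: for closed `f` and `g`, `agree` evaluates all 2^k assignments during type
-- checking, so `refl` discharges the hypothesis.
truthTable : ∀ k (f g : Op k) → agree k f g ≡ true → Equal k f g
truthTable zero    true  true  _  = refl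
truthTable zero    false false _  = refl
truthTable (suc k) f g eq true  = truthTable k (f true)  (g true)  (proj₁ (∧-true eq))
truthTable (suc k) f g eq false =
  truthTable k (f false) (g false) (proj₂ (∧-true {agree k (f true) (g true)} eq))

false≢true : ∀ {b} → b ≡ false → b ≡ true → ∀ {a} {A : Set a} → A
false≢true refl ()

module _ {n : ℕ} where

  δ : Fin n → Fin n → Bool
  δ x y = ⌊ x ≟ y ⌋

  δ-refl : ∀ x → δ x x ≡ true
  δ-refl x with x ≟ x
  ... | yes _   = refl
  ... | no  x≢x = contradiction refl x≢x

  δ-≢ : ∀ {x y} → x ≢ y → δ x y ≡ false
  δ-≢ {x} {y} x≢y with x ≟ y
  ... | yes x≡y = contradiction x≡y x≢y
  ... | no  _   = refl

  adj⇒≢ : ∀ (A : Graph n) {x y} → adj A x y ≡ true → x ≢ y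
  adj⇒≢ A {x} xy refl = false≢true (adj-irr A x) xy

  -- The row of u in A + I.
  closed : Graph n → Fin n → Fin n → Bool
  closed A u p = adj A u p xor δ u p

  closed-≢ : ∀ A {u p} → u ≢ p → closed A u p ≡ adj A u p
  closed-≢ A {u} {p} u≢p rewrite δ-≢ u≢p = xor-identityʳ _

  closed-refl : ∀ A u → closed A u u ≡ true
  closed-refl A u rewrite adj-irr A u | δ-refl u = refl

  closed-adj : ∀ A {u p} → adj A u p ≡ true → closed A u p ≡ true
  closed-adj A up = trans (closed-≢ A (adj⇒≢ A up)) up

  -- The correction term is the determinant of the two pairs that `closed A u` and `closed A v`
  -- assign to `p` and `q`; it is `true` exactly when these pairs are distinct and nonzero. Taking
  -- rows of A + I builds the exchange of `u` and `v` into the same formula.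
  pivotAdj : Graph n → Fin n → Fin n → Fin n → Fin n → Bool
  pivotAdj A u v p q =
    adj A p q xor ((closed A u p ∧ closed A v q) xor (closed A v p ∧ closed A u q))

  private
    infixr 5 _&_
    infix 7 _⇒_

    _⇒_ : Bool → Bool → Bool
    x ⇒ y = not x ∨ y

    _&_ : ∀ {x y} → x ≡ true → y ≡ true → x ∧ y ≡ true
    refl & refl = refl

    δ⇒ : ∀ x y {b} → (x ≡ y → b ≡ true) → δ x y ⇒ b ≡ true
    δ⇒ x y h with x ≟ y
    ... | yes x≡y = h x≡y
    ... | no  _   = refl

    same : ∀ {x y} → x ≡ y → not (x xor y) ≡ true
    same {x} refl = cong not (xor-same x)

    -- A, p and q enter through the bits a = A p q, b = A u p, c = A u q, f = A v p, g = A v q and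
    -- the equalities e = (p ≡ q), i = (u ≡ p), j = (u ≡ q), k = (v ≡ p), l = (v ≡ q).
    consistent : Op 10
    consistent a b c f g e i j k l =
      e ⇒ not a ∧ i ⇒ not b ∧ j ⇒ not c ∧ k ⇒ not f ∧ l ⇒ not g ∧
      e ⇒ not (b xor c) ∧ e ⇒ not (f xor g) ∧ i ⇒ not (c xor a) ∧ j ⇒ not (b xor a) ∧
      k ⇒ not (g xor a) ∧ l ⇒ not (f xor a) ∧ i ⇒ f ∧ j ⇒ g ∧ k ⇒ b ∧ l ⇒ c ∧
      e ⇒ not (i xor j) ∧ e ⇒ not (k xor l) ∧ i ⇒ not (j xor e) ∧ k ⇒ not (l xor e)

    iterated uniform : Op 10
    iterated a b c f g e i j k l = z xor ((y₁ ∧ y₂) ∧ not e)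
      where
      x₁ = f xor ((true ∧ b) ∧ not k)
      x₂ = g xor ((true ∧ c) ∧ not l)
      z  = (a xor ((b ∧ c) ∧ not e)) xor ((x₁ ∧ x₂) ∧ not e)
      y₁ = b xor ((true ∧ x₁) ∧ not i)
      y₂ = c xor ((true ∧ x₂) ∧ not j)
    uniform  a b c f g e i j k l = a xor (((b xor i) ∧ (g xor l)) xor ((f xor k) ∧ (c xor j)))

    iterated≡uniform : ∀ a b c f g e i j k l → consistent a b c f g e i j k l ≡ true →
                       iterated a b c f g e i j k l ≡ uniform a b c f g e i j k l
    iterated≡uniform a b c f g e i j k l ok =
      -- The formulas differ on bit patterns that no graph produces; conjoining `consistent` to both
      -- sides turns the claim into an identity on all assignments.
      subst (λ o → o ∧ iterated a b c f g e i j k l ≡ o ∧ uniform a b c f g e i j k l) ok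
        (truthTable 10 (λ a b c f g e i j k l → consistent a b c f g e i j k l ∧ iterated a b c f g e i j k l)
                       (λ a b c f g e i j k l → consistent a b c f g e i j k l ∧ uniform a b c f g e i j k l)
                       refl a b c f g e i j k l)

  pivot-adj : ∀ (A : Graph n) u v (uv : Adjacent A u v) p q →
              adj (pivot A u v uv) p q ≡ pivotAdj A u v p q
  pivot-adj A u v uv p q = trans unfold
    (iterated≡uniform (adj A p q) (adj A u p) (adj A u q) (adj A v p) (adj A v q)
       (δ p q) (δ u p) (δ u q) (δ v p) (δ v q)
      ( δ⇒ p q (λ { refl → cong not (adj-irr A p) }) & δ⇒ u p (λ { refl → cong not (adj-irr A p) })
      & δ⇒ u q (λ { refl → cong not (adj-irr A q) }) & δ⇒ v p (λ { refl → cong not (adj-irr A p) })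
      & δ⇒ v q (λ { refl → cong not (adj-irr A q) })
      & δ⇒ p q (λ { refl → same {adj A u p} refl }) & δ⇒ p q (λ { refl → same {adj A v p} refl })
      & δ⇒ u p (λ { refl → same {adj A u q} refl }) & δ⇒ u q (λ { refl → same (adj-sym A u p) })
      & δ⇒ v p (λ { refl → same {adj A v q} refl }) & δ⇒ v q (λ { refl → same (adj-sym A v p) })
      & δ⇒ u p (λ { refl → vu }) & δ⇒ u q (λ { refl → vu })
      & δ⇒ v p (λ { refl → uv }) & δ⇒ v q (λ { refl → uv })
      & δ⇒ p q (λ { refl → same {δ u p} refl }) & δ⇒ p q (λ { refl → same {δ v p} refl })
      & δ⇒ u p (λ { refl → same {δ u q} refl }) & δ⇒ v p (λ { refl → same {δ v q} refl })))
    where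
    vu = trans (adj-sym A v u) uv
    unfold : adj (pivot A u v uv) p q ≡
             iterated (adj A p q) (adj A u p) (adj A u q) (adj A v p) (adj A v q)
               (δ p q) (δ u p) (δ u q) (δ v p) (δ v q)
    unfold rewrite adj-irr A u | vu | uv | xor-identityʳ (adj A u p) | xor-identityʳ (adj A u q) = refl

  infixl 6 _⊕_

  _⊕_ : (Fin n → Bool) → (Fin n → Bool) → Fin n → Bool
  (x ⊕ y) v = x v xor y v

  infix 7 _∙_

  _∙_ : (Fin n → Bool) → (Fin n → Bool) → Bool
  f ∙ x = sum (λ v → f v ∧ x v)

  ∙-cong : ∀ {f g x y} → (∀ v → f v ≡ g v) → (∀ v → x v ≡ y v) → f ∙ x ≡ g ∙ y
  ∙-cong f≗g x≗y = sum-cong-≗ (λ v → cong₂ _∧_ (f≗g v) (x≗y v))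

  ∙-⊕ʳ : ∀ f x y → f ∙ (x ⊕ y) ≡ f ∙ x xor f ∙ y
  ∙-⊕ʳ f x y = trans (sum-cong-≗ (λ v → ∧-distribˡ-xor (f v) (x v) (y v)))
                     (∑-distrib-+ (λ v → f v ∧ x v) (λ v → f v ∧ y v))

  ∙-⊕ˡ : ∀ f g x → (f ⊕ g) ∙ x ≡ f ∙ x xor g ∙ x
  ∙-⊕ˡ f g x = trans (sum-cong-≗ (λ v → ∧-distribʳ-xor (x v) (f v) (g v)))
                     (∑-distrib-+ (λ v → f v ∧ x v) (λ v → g v ∧ x v))

  ∙-scaleˡ : ∀ k f x → (λ v → k ∧ f v) ∙ x ≡ k ∧ f ∙ x
  ∙-scaleˡ k f x = trans (sum-cong-≗ (λ v → ∧-assoc k (f v) (x v)))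
                         (sym (*-distribˡ-sum k (λ v → f v ∧ x v)))

  ∙-scaleʳ : ∀ k f x → f ∙ (λ v → k ∧ x v) ≡ k ∧ f ∙ x
  ∙-scaleʳ k f x = trans (sum-cong-≗ (λ v → truthTable 3 (λ k f x → f ∧ (k ∧ x)) (λ k f x → k ∧ (f ∧ x))
                                                refl k (f v) (x v)))
                         (sym (*-distribˡ-sum k (λ v → f v ∧ x v)))

  ∙-disjoint : ∀ f x → (∀ v → f v ∧ x v ≡ false) → f ∙ x ≡ false
  ∙-disjoint f x disjoint = trans (sum-cong-≗ disjoint) (sum-replicate-zero n)

  ∙-zeroʳ : ∀ f {x} → (∀ v → x v ≡ false) → f ∙ x ≡ false
  ∙-zeroʳ f x≗0 = ∙-disjoint f _ (λ v → trans (cong (f v ∧_) (x≗0 v)) (∧-zeroʳ (f v)))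

sum-δ : ∀ {n} (u : Fin n) f → sum (λ v → f v ∧ δ u v) ≡ f u
sum-δ {suc n} zero    f =
  trans (cong₂ _xor_ (∧-identityʳ (f zero))
           (trans (sum-cong-≗ (λ v → trans (cong (f (suc v) ∧_) (δ-≢ {x = zero} {suc v} λ ())) (∧-zeroʳ _)))
                  (sum-replicate-zero n)))
        (xor-identityʳ (f zero))
sum-δ {suc n} (suc u) f =
  cong₂ _xor_ (trans (cong (f zero ∧_) (δ-≢ {x = suc u} {zero} λ ())) (∧-zeroʳ (f zero)))
    (trans (sum-cong-≗ (λ v → cong (f (suc v) ∧_) (δ-suc u v))) (sum-δ u (λ v → f (suc v))))
  where
  δ-suc : ∀ {n} (u v : Fin n) → δ (suc u) (suc v) ≡ δ u v
  δ-suc u v with u ≟ v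
  ... | yes _ = refl
  ... | no  _ = refl

-- Principal pivot transforms as exchanges of coordinates

module _ {n : ℕ} where

  -- The increment that, added to both `x` and `A x`, swaps their coordinates in `X`.
  exchanged : Graph n → (Fin n → Bool) → (Fin n → Bool) → Fin n → Bool
  exchanged A X x v = X v ∧ (x v xor adj A v ∙ x)

  -- B is the principal pivot transform of A on X: if y = A x, then swapping the coordinates
  -- of x and y in X turns (x , y) into a pair (x′ , y′) with y′ = B x′.
  record PPT (A : Graph n) (X : Fin n → Bool) (B : Graph n) : Set where
    constructor mkPPT
    field
      exchange : ∀ x v → adj B v ∙ (x ⊕ exchanged A X x) ≡ adj A v ∙ x xor exchanged A X x v

  open PPT public

  ppt-∅ : ∀ A {X} → (∀ v → X v ≡ false) → PPT A X A
  ppt-∅ A {X} X≗∅ .exchange x v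
    rewrite X≗∅ v | xor-identityʳ (adj A v ∙ x) =
    ∙-cong (λ _ → refl) (λ w → trans (cong (λ b → x w xor (b ∧ _)) (X≗∅ w)) (xor-identityʳ (x w)))

  -- A second swap of a coordinate undoes the first, so only the symmetric difference stays swapped.
  -- Describing transforms by vectors makes this pointwise, without matrix inverses.
  ppt-∘ : ∀ {A B C X Y} → PPT A X B → PPT B Y C → PPT A (X ⊕ Y) C
  ppt-∘ {A} {B} {C} {X} {Y} AB BC .exchange x v =
    trans (∙-cong {f = adj C v} (λ _ → refl) left) (trans (exchange BC x′ v) right)
    where
    x′ = x ⊕ exchanged A X x

    left : ∀ w → (x ⊕ exchanged A (X ⊕ Y) x) w ≡ (x′ ⊕ exchanged B Y x′) w
    left w rewrite exchange AB x w =
      truthTable 4 (λ X Y x y → x xor ((X xor Y) ∧ (x xor y)))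
        (λ X Y x y → (x xor (X ∧ (x xor y))) xor
           (Y ∧ ((x xor (X ∧ (x xor y))) xor (y xor (X ∧ (x xor y))))))
        refl (X w) (Y w) (x w) (adj A w ∙ x)

    right : adj B v ∙ x′ xor exchanged B Y x′ v ≡ adj A v ∙ x xor exchanged A (X ⊕ Y) x v
    right rewrite exchange AB x v =
      truthTable 4
        (λ X Y x y → (y xor (X ∧ (x xor y))) xor
           (Y ∧ ((x xor (X ∧ (x xor y))) xor (y xor (X ∧ (x xor y))))))
        (λ X Y x y → y xor ((X xor Y) ∧ (x xor y)))
        refl (X v) (Y v) (x v) (adj A v ∙ x)

  ppt-congʳ : ∀ {A B C X} → (∀ p q → adj B p q ≡ adj C p q) → PPT A X B → PPT A X C
  ppt-congʳ B≗C AB .exchange x v =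
    trans (∙-cong (λ w → sym (B≗C v w)) (λ _ → refl)) (exchange AB x v)

  pair : Fin n → Fin n → Fin n → Bool
  pair u v w = δ u w xor δ v w

  -- The vector `x′` adds `λu` at `u` and `λv` at `v`. The closed rows of `u` and `v` send it to
  -- `λv` and `λu`, so the rank-two correction in `pivotAdj` supplies exactly the terms required.
  ppt-pivot : ∀ (A : Graph n) u v (uv : Adjacent A u v) → PPT A (pair u v) (pivot A u v uv)
  ppt-pivot A u v uv .exchange x p = trans (∙-cong (pivot-adj A u v uv p) x′≗) (trans expand final)
    where
    y : Fin n → Bool
    y w = adj A w ∙ x
    λu λv : Bool
    λu = x u xor y u
    λv = x v xor y v
    vu = trans (adj-sym A v u) uv

    x′ : Fin n → Bool
    x′ = x ⊕ (λ w → λu ∧ δ u w) ⊕ (λ w → λv ∧ δ v w)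

    exchanged≗ : ∀ w → exchanged A (pair u v) x w ≡ (λu ∧ δ u w) xor (λv ∧ δ v w)
    exchanged≗ w with u ≟ w | v ≟ w
    ... | yes refl | yes refl = contradiction refl (adj⇒≢ A uv)
    ... | yes refl | no _     = truthTable 2 (λ l k → l) (λ l k → (l ∧ true) xor (k ∧ false)) refl λu λv
    ... | no _     | yes refl = truthTable 2 (λ l k → k) (λ l k → (l ∧ false) xor (k ∧ true)) refl λu λv
    ... | no _     | no _     = truthTable 2 (λ l k → false) (λ l k → (l ∧ false) xor (k ∧ false)) refl λu λv

    x′≗ : ∀ w → (x ⊕ exchanged A (pair u v) x) w ≡ x′ w
    x′≗ w = trans (cong (x w xor_) (exchanged≗ w)) (sym (xor-assoc (x w) (λu ∧ δ u w) (λv ∧ δ v w)))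

    ∙-x′ : ∀ f → f ∙ x′ ≡ (f ∙ x xor (λu ∧ f u)) xor (λv ∧ f v)
    ∙-x′ f = trans (∙-⊕ʳ f (x ⊕ _) _)
      (cong₂ _xor_ (trans (∙-⊕ʳ f x _) (cong (f ∙ x xor_)
                     (trans (∙-scaleʳ λu f (δ u)) (cong (λu ∧_) (sum-δ u f)))))
                   (trans (∙-scaleʳ λv f (δ v)) (cong (λv ∧_) (sum-δ v f))))

    closed∙x : ∀ w → closed A w ∙ x ≡ y w xor x w
    closed∙x w = trans (∙-⊕ˡ (adj A w) (δ w) x)
      (cong (y w xor_) (trans (sum-cong-≗ (λ z → ∧-comm (δ w z) (x z))) (sum-δ w x)))

    closedu∙x′ : closed A u ∙ x′ ≡ λv
    closedu∙x′ rewrite ∙-x′ (closed A u) | closed∙x u | closed-refl A u | closed-adj A uv =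
      truthTable 3 (λ x y l → ((y xor x) xor ((x xor y) ∧ true)) xor (l ∧ true)) (λ x y l → l) refl (x u) (y u) λv

    closedv∙x′ : closed A v ∙ x′ ≡ λu
    closedv∙x′ rewrite ∙-x′ (closed A v) | closed∙x v | closed-refl A v | closed-adj A vu =
      truthTable 3 (λ x y l → ((y xor x) xor (l ∧ true)) xor ((x xor y) ∧ true)) (λ x y l → l) refl (x v) (y v) λu

    expand : pivotAdj A u v p ∙ x′ ≡
             adj A p ∙ x′ xor ((closed A u p ∧ λu) xor (closed A v p ∧ λv))
    expand = trans (∙-⊕ˡ (adj A p) _ x′) (cong (adj A p ∙ x′ xor_)
      (trans (∙-⊕ˡ (λ q → closed A u p ∧ closed A v q) (λ q → closed A v p ∧ closed A u q) x′)
        (cong₂ _xor_ (trans (∙-scaleˡ (closed A u p) (closed A v) x′) (cong (closed A u p ∧_) closedv∙x′))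
                     (trans (∙-scaleˡ (closed A v p) (closed A u) x′) (cong (closed A v p ∧_) closedu∙x′)))))

    final : adj A p ∙ x′ xor ((closed A u p ∧ λu) xor (closed A v p ∧ λv)) ≡
            y p xor exchanged A (pair u v) x p
    final rewrite ∙-x′ (adj A p) | exchanged≗ p | adj-sym A p u | adj-sym A p v =
      truthTable 7 (λ y l k a b i j → ((y xor (l ∧ a)) xor (k ∧ b)) xor (((a xor i) ∧ l) xor ((b xor j) ∧ k)))
                   (λ y l k a b i j → y xor ((l ∧ i) xor (k ∧ j)))
                   refl (y p) λu λv (adj A u p) (adj A v p) (δ u p) (δ v p)

  pivot-uv : ∀ (A : Graph n) u v (uv : Adjacent A u v) → adj (pivot A u v uv) u v ≡ true
  pivot-uv A u v uv
    rewrite pivot-adj A u v uv u v | closed-refl A u | closed-refl A v | closed-adj A uv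
      | closed-adj A (trans (adj-sym A v u) uv) | uv = refl

  -- The pivot swaps the closed rows of `u` and `v`, and the correction term is symmetric in them;
  -- the second pivot adds the same term again.
  pivot-involutive : ∀ (A : Graph n) u v (uv : Adjacent A u v) (uv′ : Adjacent (pivot A u v uv) u v) p q →
                     adj (pivot (pivot A u v uv) u v uv′) p q ≡ adj A p q
  pivot-involutive A u v uv uv′ p q = trans (pivot-adj B u v uv′ p q) collapse
    where
    B = pivot A u v uv
    vu = trans (adj-sym A v u) uv

    closedu : ∀ w → closed B u w ≡ closed A v w
    closedu w rewrite pivot-adj A u v uv u w | closed-refl A u | closed-adj A vu =
      truthTable 3 (λ a i b → (a xor (b xor (a xor i))) xor i) (λ a i b → b) refl
        (adj A u w) (δ u w) (closed A v w)

    closedv : ∀ w → closed B v w ≡ closed A u w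
    closedv w rewrite pivot-adj A u v uv v w | closed-refl A v | closed-adj A uv =
      truthTable 3 (λ a i b → (a xor ((a xor i) xor b)) xor i) (λ a i b → b) refl
        (adj A v w) (δ v w) (closed A u w)

    collapse : pivotAdj B u v p q ≡ adj A p q
    collapse rewrite closedu p | closedu q | closedv p | closedv q | pivot-adj A u v uv p q =
      truthTable 5 (λ a b c d e → (a xor ((b ∧ c) xor (d ∧ e))) xor ((d ∧ e) xor (b ∧ c))) (λ a b c d e → a) refl
        (adj A p q) (closed A u p) (closed A v q) (closed A v p) (closed A u q)

  -- All transforms are kept pointing at `G`; in this orientation a pivot of `A` can be prefixed to
  -- `PPT A X G` by `ppt-∘`.
  ppt-unpivot : ∀ (A : Graph n) u v (uv : Adjacent A u v) → PPT (pivot A u v uv) (pair u v) A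
  ppt-unpivot A u v uv =
    ppt-congʳ {B = pivot B u v uv′} (pivot-involutive A u v uv uv′) (ppt-pivot B u v uv′)
    where
    B = pivot A u v uv
    uv′ : Adjacent B u v
    uv′ = pivot-uv A u v uv

-- Transforms realised within induced subgraphs

module _ {n : ℕ} where

  ∙-δ : ∀ f (u : Fin n) → f ∙ δ u ≡ f u
  ∙-δ f u = sum-δ u f

  -- This is the nonsingularity of `A` on `X`: for such an `x` the exchanged vector vanishes, yet
  -- `B` maps it to a vector that equals `x` on `X`.
  ppt-kernel : ∀ {A B : Graph n} {X} → PPT A X B → ∀ x →
               (∀ v → X v ≡ true → adj A v ∙ x ≡ false) →
               (∀ v → X v ≡ false → x v ≡ false) →
               ∀ v → x v ≡ false
  ppt-kernel {A} {B} {X} AB x Ax≡0 x≡0 v with X v in Xv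
  ... | false = x≡0 v Xv
  ... | true  = trans (sym step) (∙-zeroʳ (adj B v) x′≡0)
    where
    x′≡0 : ∀ w → (x ⊕ exchanged A X x) w ≡ false
    x′≡0 w with X w in Xw
    ... | false rewrite x≡0 w Xw = refl
    ... | true rewrite Ax≡0 w Xw | xor-identityʳ (x w) = xor-same (x w)

    step : adj B v ∙ (x ⊕ exchanged A X x) ≡ x v
    step rewrite exchange AB x v | Xv | Ax≡0 v Xv = xor-identityʳ (x v)

  -- Otherwise the unit vector `δ u` would lie in the kernel of `A` on `X`.
  neighbour-in : ∀ {A B : Graph n} {X} → PPT A X B → ∀ u → X u ≡ true →
                 ∃[ v ] (X v ≡ true × adj A u v ≡ true)
  neighbour-in {A} {B} {X} AB u Xu
    with any? (λ v → (X v Bool.≟ true) ×-dec (adj A u v Bool.≟ true))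
  ... | yes found = found
  ... | no  none  = false≢true (ppt-kernel AB (δ u) no-edge outside-X u) (δ-refl u)
    where
    no-edge : ∀ v → X v ≡ true → adj A v ∙ δ u ≡ false
    no-edge v Xv = trans (∙-δ (adj A v) u)
      (¬-not (λ vu → none (v , Xv , trans (adj-sym A u v) vu)))

    outside-X : ∀ v → X v ≡ false → δ u v ≡ false
    outside-X v Xv = δ-≢ (λ { refl → false≢true Xv Xu })

  ppt-∅⇒≗ : ∀ {A B : Graph n} {X} → PPT A X B → (∀ v → X v ≡ false) →
            ∀ p q → adj A p q ≡ adj B p q
  ppt-∅⇒≗ {A} {B} {X} AB X≡∅ p q = sym (begin
    adj B p q                                  ≡⟨ ∙-δ (adj B p) q ⟨
    adj B p ∙ δ q                              ≡⟨ ∙-cong (λ _ → refl) unmoved ⟨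
    adj B p ∙ (δ q ⊕ exchanged A X (δ q))      ≡⟨ exchange AB (δ q) p ⟩
    adj A p ∙ δ q xor exchanged A X (δ q) p    ≡⟨ cong₂ _xor_ (∙-δ (adj A p) q) (none p) ⟩
    adj A p q xor false                        ≡⟨ xor-identityʳ _ ⟩
    adj A p q                                  ∎)
    where
    open ≡-Reasoning
    none : ∀ w → exchanged A X (δ q) w ≡ false
    none w rewrite X≡∅ w = refl
    unmoved : ∀ w → (δ q ⊕ exchanged A X (δ q)) w ≡ δ q w
    unmoved w = trans (cong (δ q w xor_) (none w)) (xor-identityʳ _)

-- Unlike _≅_, f need not be onto: H is an induced subgraph of G.
record Embedding {m n} (H : Graph m) (G : Graph n) : Set where
  field
    to        : Fin m → Fin n
    injective : Injective _≡_ _≡_ to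
    preserves : ∀ i j → adj H i j ≡ adj G (to i) (to j)


open Embedding

δ-injective : ∀ {m n} {f : Fin m → Fin n} → Injective _≡_ _≡_ f → ∀ i j → δ i j ≡ δ (f i) (f j)
δ-injective {f = f} inj i j with i ≟ j
... | yes refl = sym (δ-refl (f i))
... | no  i≢j  = sym (δ-≢ (i≢j ∘ inj))

closed-embedding : ∀ {m n} {H : Graph m} {G : Graph n} (f : Embedding H G) u v →
                   closed H u v ≡ closed G (to f u) (to f v)
closed-embedding f u v = cong₂ _xor_ (preserves f u v) (δ-injective (injective f) u v)

pivotAdj-embedding : ∀ {m n} {H : Graph m} {G : Graph n} (f : Embedding H G) → ∀ i j p q →
                     pivotAdj H i j p q ≡ pivotAdj G (to f i) (to f j) (to f p) (to f q)
pivotAdj-embedding f i j p q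
  rewrite closed-embedding f i p | closed-embedding f i q | closed-embedding f j p
    | closed-embedding f j q | preserves f p q = refl

pivot-embedding : ∀ {m n} {H : Graph m} {G : Graph n} (f : Embedding H G) →
                  ∀ u v (uv : Adjacent H u v) (uv′ : Adjacent G (to f u) (to f v)) →
                  Embedding (pivot H u v uv) (pivot G (to f u) (to f v) uv′)
pivot-embedding f u v uv uv′ .to = to f
pivot-embedding f u v uv uv′ .injective = injective f
pivot-embedding {H = H} {G} f u v uv uv′ .preserves i j =
  trans (pivot-adj H u v uv i j)
    (trans (pivotAdj-embedding f u v i j) (sym (pivot-adj G _ _ uv′ _ _)))

-- Deletions are postponed: every pivot is performed on all `n` vertices, and the graph that remains
-- is tracked only as an induced subgraph.
⟶*⇒ppt : ∀ {m n} {G : Graph n} {H : Graph m} → G ⟶* H →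
         ∃[ A ] ∃[ X ] (PPT A X G × Embedding H A)
⟶*⇒ppt {G = G} done = G , (λ _ → false) , ppt-∅ G (λ _ → refl) ,
  record { to = λ i → i ; injective = λ eq → eq ; preserves = λ _ _ → refl }
⟶*⇒ppt (thenDel {H = H} s v) with A , X , AG , f ← ⟶*⇒ppt s = A , X , AG , record
  { to        = to f ∘ punchIn v
  ; injective = punchIn-injective v _ _ ∘ injective f
  ; preserves = λ i j → preserves f (punchIn v i) (punchIn v j) }
⟶*⇒ppt (thenPivot s u v uv) with A , X , AG , f ← ⟶*⇒ppt s =
  pivot A (to f u) (to f v) uv′ , pair (to f u) (to f v) ⊕ X ,
  ppt-∘ (ppt-unpivot A (to f u) (to f v) uv′) AG , pivot-embedding f u v uv uv′
  where
  uv′ = trans (sym (preserves f u v)) uv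

embedding⇒pivotMinor : ∀ {l m n} {G : Graph n} {H : Graph l} {B : Graph m} →
                       G ⟶* B → Embedding H B → HasPivotMinor G H
embedding⇒pivotMinor {m = m} {H = H} {B} s f
  with any? (λ v → ¬? (any? (λ i → to f i ≟ v)))
embedding⇒pivotMinor {m = suc m} {H = H} {B} s f | yes (v , v∉f) =
  embedding⇒pivotMinor {H = H} {B = deleteVertex B v} (thenDel s v) record
    { to        = λ i → punchOut (v≢ i)
    ; injective = λ {i} {j} eq → injective f (punchOut-injective (v≢ i) (v≢ j) eq)
    ; preserves = λ i j → trans (preserves f i j)
        (sym (cong₂ (adj B) (punchIn-punchOut (v≢ i)) (punchIn-punchOut (v≢ j)))) }
  where
  v≢ : ∀ i → v ≢ to f i
  v≢ i eq = v∉f (i , sym eq)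
embedding⇒pivotMinor {m = m} {H = H} {B} s f | no onto =
  m , B , s , mk↔ₛ′ from (to f) (λ i → injective f (to-from (to f i))) to-from ,
  λ x y → trans (sym (cong₂ (adj B) (to-from x) (to-from y))) (sym (preserves f (from x) (from y)))
  where
  preimage : ∀ v → ∃[ i ] to f i ≡ v
  preimage v = decidable-stable (any? (λ i → to f i ≟ v)) (λ ∄ → onto (v , ∄))
  from : Fin m → Fin _
  from v = proj₁ (preimage v)
  to-from : ∀ v → to f (from v) ≡ v
  to-from v = proj₂ (preimage v)

-- Nonsingularity gives the largest vertex `u` of `Z` a neighbour `v` in `Z`, and pivoting on `u v`
-- removes both from `Z`. The transform is thus a sequence of pivots inside `Z`, available in any
-- induced subgraph containing `Z`. The bound `d` on the indices in `Z` makes the recursion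
-- structural.
realise : ∀ {k n} (G : Graph n) {e : Fin k → Fin n} → Injective _≡_ _≡_ e →
          ∀ d (A : Graph n) Z → PPT A Z G →
          (∀ v → Z v ≡ true → toℕ v < d) → (∀ v → Z v ≡ true → ∃[ i ] e i ≡ v) →
          Σ[ B ∈ Graph k ] (pullback G e ⟶* B × (∀ i j → adj B i j ≡ adj A (e i) (e j)))
realise G e-inj zero A Z AG Z<d Z⊆e =
  pullback G _ , done , λ i j → sym (ppt-∅⇒≗ AG (λ v → ¬-not (λ Zv → contradiction (Z<d v Zv) λ ())) _ _)
realise {k} {n} G {e} e-inj (suc d) A Z AG Z<d Z⊆e
  with any? (λ u → (Z u Bool.≟ true) ×-dec (toℕ u ℕ.≟ d))
... | no  none = realise G e-inj d A Z AG
  (λ v Zv → ℕ.≤∧≢⇒< (ℕ.<⇒≤pred (Z<d v Zv)) (λ eq → none (v , Zv , eq))) Z⊆e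
... | yes (u , Zu , u≡d) with neighbour-in AG u Zu
... | v , Zv , uv with Z⊆e u Zu | Z⊆e v Zv
... | i , refl | j , refl = step
  where
  A′ : Graph n
  A′ = pivot A u v uv
  Z′ : Fin n → Bool
  Z′ = pair u v ⊕ Z
  uv′ : Adjacent A′ u v
  uv′ = pivot-uv A u v uv

  Z′-u : Z′ u ≡ false
  Z′-u rewrite Zu | δ-refl u | δ-≢ (adj⇒≢ A (trans (adj-sym A v u) uv)) = refl

  Z′-v : Z′ v ≡ false
  Z′-v rewrite Zv | δ-refl v | δ-≢ (adj⇒≢ A uv) = refl

  Z′⊆Z : ∀ w → Z′ w ≡ true → w ≢ u × Z w ≡ true
  Z′⊆Z w Z′w = w≢u , trans (sym Z′-w) Z′w
    where
    w≢u : w ≢ u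
    w≢u w≡u = false≢true (trans (cong Z′ w≡u) Z′-u) Z′w
    w≢v : w ≢ v
    w≢v w≡v = false≢true (trans (cong Z′ w≡v) Z′-v) Z′w
    Z′-w : Z′ w ≡ Z w
    Z′-w rewrite δ-≢ (w≢u ∘ sym) | δ-≢ (w≢v ∘ sym) = refl

  step : Σ[ B ∈ Graph k ] (pullback G e ⟶* B × (∀ i j → adj B i j ≡ adj A (e i) (e j)))
  step with realise G e-inj d A′ Z′ (ppt-∘ (ppt-unpivot A u v uv) AG)
    (λ w Z′w → let w≢u , Zw = Z′⊆Z w Z′w in
      ℕ.≤∧≢⇒< (ℕ.<⇒≤pred (Z<d w Zw)) (λ eq → w≢u (toℕ-injective (trans eq (sym u≡d)))))
    (λ w Z′w → Z⊆e w (proj₂ (Z′⊆Z w Z′w)))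
  -- `B` realises the pivoted graph `A′`; pivoting it once more on the same edge gives back `A`.
  ... | B , s , B≗ = pivot B i j ij , thenPivot s i j ij , λ p q →
    trans (preserves (pivot-embedding f i j ij uv′) p q) (pivot-involutive A u v uv uv′ (e p) (e q))
    where
    f : Embedding B A′
    f = record { to = e ; injective = e-inj ; preserves = B≗ }
    ij : Adjacent B i j
    ij = trans (B≗ i j) uv′

enum-injective : ∀ {n} (S : Subset n) → Injective _≡_ _≡_ (enum S)
enum-injective (true  ∷ S) {zero}  {zero}  _  = refl
enum-injective (true  ∷ S) {suc i} {suc j} eq = cong suc (enum-injective S (suc-injective eq))
enum-injective (false ∷ S) eq = enum-injective S (suc-injective eq)

enum-onto : ∀ {n} (S : Subset n) {v} → v ∈ₛ S → ∃[ i ] enum S i ≡ v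
enum-onto (true  ∷ S) here = zero , refl
enum-onto (true  ∷ S) (there v∈S) with i , eq ← enum-onto S v∈S = suc i , cong suc eq
enum-onto (false ∷ S) (there v∈S) with i , eq ← enum-onto S v∈S = i , cong suc eq

-- Were `v` outside `X`, `realise` would carry out the transform in `G` without `v`, and the copy,
-- which misses `v`, would survive there.
minimal⇒inside : ∀ {m n} {G : Graph n} {H : Graph m} → MinimalWithPivotMinor G H →
                 ∀ {A X} → PPT A X G → (f : Embedding H A) →
                 ∀ v → (∀ i → to f i ≢ v) → X v ≡ true
minimal⇒inside {m} {n} {G} {H} (_ , minimal) {A} {X} AG f v v∉f with X v in Xv
... | true  = refl
... | false = contradiction minor (minimal S (x∈p⇒p-x⊂p ∈⊤))
  where
  S : Subset n
  S = ⊤ - v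
  label : ∀ {w} → w ≢ v → ∃[ i ] enum S i ≡ w
  label w≢v = enum-onto S (x∈p∧x≢y⇒x∈p-y ∈⊤ w≢v)
  minor : HasPivotMinor (G [ S ]) H
  minor with realise G (enum-injective S) n A X AG (λ w _ → toℕ<n w)
               (λ w Xw → label (λ { refl → false≢true Xv Xw }))
  ... | B , s , B≗ = embedding⇒pivotMinor {H = H} {B = B} s record
    { to        = λ i → proj₁ (label (v∉f i))
    ; injective = λ {i} {j} eq → injective f
        (trans (sym (proj₂ (label (v∉f i)))) (trans (cong (enum S) eq) (proj₂ (label (v∉f j)))))
    ; preserves = λ i j → trans (preserves f i j) (trans
        (sym (cong₂ (adj A) (proj₂ (label (v∉f i))) (proj₂ (label (v∉f j))))) (sym (B≗ _ _))) }

minimal⇒ppt : ∀ {m n} {G : Graph n} {H : Graph m} → MinimalWithPivotMinor G H →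
              ∃[ A ] ∃[ X ] (PPT A X G × Embedding H A)
minimal⇒ppt {H = H} ((k , H′ , s , φ , iso) , _) with A , X , AG , f ← ⟶*⇒ppt s = A , X , AG , record
  { to        = to f ∘ Inverse.from φ
  ; injective = λ {x} {y} eq → trans (sym (Inverse.strictlyInverseˡ φ x))
      (trans (cong (Inverse.to φ) (injective f eq)) (Inverse.strictlyInverseˡ φ y))
  ; preserves = λ i j → trans (sym (trans (iso _ _)
      (cong₂ (adj H) (Inverse.strictlyInverseˡ φ i) (Inverse.strictlyInverseˡ φ j)))) (preserves f _ _) }

-- Counting

module _ {A : Set} where

  length-filter-¬ : ∀ {P : A → Set} (P? : Decidable P) xs →
                    length xs ≡ length (filter P? xs) + length (filter (¬? ∘ P?) xs)
  length-filter-¬ P? []       = refl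
  length-filter-¬ P? (x ∷ xs) with P? x
  ... | yes _ = cong suc (length-filter-¬ P? xs)
  ... | no  _ = trans (cong suc (length-filter-¬ P? xs)) (sym (ℕ.+-suc _ _))

  lookup-injective : ∀ {xs : List A} → Unique xs → Injective _≡_ _≡_ (lookup xs)
  lookup-injective {x ∷ xs} _ {zero}  {zero}  _  = refl
  lookup-injective {x ∷ xs} u {zero}  {suc j} eq =
    contradiction (subst (_∈ xs) (sym eq) (∈-lookup j)) (Unique[x∷xs]⇒x∉xs u)
  lookup-injective {x ∷ xs} u {suc i} {zero}  eq =
    contradiction (subst (_∈ xs) eq (∈-lookup i)) (Unique[x∷xs]⇒x∉xs u)
  lookup-injective {x ∷ xs} (_ ∷ u) {suc i} {suc j} eq = cong suc (lookup-injective u eq)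

  choose : ∀ {xs : List A} k → Unique xs → k ≤ length xs →
           Σ[ g ∈ (Fin k → A) ] (Injective _≡_ _≡_ g × (∀ i → g i ∈ xs))
  choose {xs} k u k≤ = lookup xs ∘ (λ i → inject≤ i k≤) ,
    (λ eq → inject≤-injective k≤ k≤ _ _ (lookup-injective u eq)) , (λ i → ∈-lookup (inject≤ i k≤))

  -- Pigeonhole, with large fibres presented as injective families: this is the form in which
  -- `few-twins` and `few-leaf-neighbours` refute them.
  length≤fibres : ∀ {xs : List A} → Unique xs → ∀ m k (f : A → ℕ) → (∀ {x} → x ∈ xs → f x < m) →
                  (∀ (g : Fin (suc k) → A) → Injective _≡_ _≡_ g → (∀ i → g i ∈ xs) →
                     ¬ (∀ i → f (g i) ≡ f (g zero))) →
                  length xs ≤ m * k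
  length≤fibres {[]}     u zero    k f f< small = z≤n
  length≤fibres {x ∷ xs} u zero    k f f< small = contradiction (f< (here refl)) λ ()
  length≤fibres {xs}     u (suc m) k f f< small = begin
    length xs                                                      ≡⟨ length-filter-¬ m? xs ⟩
    length (filter m? xs) + length (filter (¬? ∘ m?) xs)           ≤⟨ ℕ.+-mono-≤ top≤ rest≤ ⟩
    k + m * k                                                      ∎
    where
    open ℕ.≤-Reasoning
    m? : Decidable (λ x → f x ≡ m)
    m? x = f x ℕ.≟ m
    top≤ : length (filter m? xs) ≤ k
    top≤ = ℕ.≮⇒≥ (λ k< → let g , inj , g∈ = choose (suc k) (filter⁺ m? u) k<
                             fg i = proj₂ (∈-filter⁻ m? {xs = xs} (g∈ i)) in
      small g inj (λ i → proj₁ (∈-filter⁻ m? {xs = xs} (g∈ i))) (λ i → trans (fg i) (sym (fg zero))))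
    rest≤ : length (filter (¬? ∘ m?) xs) ≤ m * k
    rest≤ = length≤fibres (filter⁺ (¬? ∘ m?) u) m k f
      (λ x∈ → let x∈xs , fx≢m = ∈-filter⁻ (¬? ∘ m?) {xs = xs} x∈ in ℕ.≤∧≢⇒< (ℕ.<⇒≤pred (f< x∈xs)) fx≢m)
      (λ g inj g∈ → small g inj (λ i → proj₁ (∈-filter⁻ (¬? ∘ m?) {xs = xs} (g∈ i))))

-- Boolean vectors and linear dependence

toBit : Bool → Fin 2
toBit = Inverse.from 2↔Bool

fromBit : Fin 2 → Bool
fromBit = Inverse.to 2↔Bool

fromBit-toBit : ∀ b → fromBit (toBit b) ≡ b
fromBit-toBit = Inverse.strictlyInverseˡ 2↔Bool

fromBit-injective : ∀ {i j} → fromBit i ≡ fromBit j → i ≡ j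
fromBit-injective {i} {j} eq = trans (sym (Inverse.strictlyInverseʳ 2↔Bool i))
  (trans (cong toBit eq) (Inverse.strictlyInverseʳ 2↔Bool j))

encode : ∀ {r} → (Fin r → Bool) → Fin (2 ^ r)
encode f = funToFin (toBit ∘ f)

decode : ∀ {r} → Fin (2 ^ r) → Fin r → Bool
decode i = fromBit ∘ finToFun i

encode-injective : ∀ {r} {f g : Fin r → Bool} → encode f ≡ encode g → ∀ i → f i ≡ g i
encode-injective {f = f} {g} eq i = begin
  f i                                        ≡⟨ fromBit-toBit (f i) ⟨
  fromBit (toBit (f i))                      ≡⟨ cong fromBit (finToFun-funToFin (toBit ∘ f) i) ⟨
  decode (encode f) i                        ≡⟨ cong (λ e → decode e i) eq ⟩
  decode (encode g) i                        ≡⟨ cong fromBit (finToFun-funToFin (toBit ∘ g) i) ⟩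
  fromBit (toBit (g i))                      ≡⟨ fromBit-toBit (g i) ⟩
  g i                                        ∎
  where open ≡-Reasoning

funToFin-cong : ∀ {m n} {f g : Fin m → Fin n} → (∀ i → f i ≡ g i) → funToFin f ≡ funToFin g
funToFin-cong {zero}  f≗g = refl
funToFin-cong {suc m} f≗g rewrite f≗g zero | funToFin-cong (f≗g ∘ suc) = refl

decode-differs : ∀ {r} {i j : Fin (2 ^ r)} → i ≢ j → ∃[ p ] decode {r} i p xor decode {r} j p ≡ true
decode-differs {r} {i} {j} i≢j with any? (λ p → (decode {r} i p xor decode {r} j p) Bool.≟ true)
... | yes found = found
... | no  none  = contradiction
  (trans (sym (funToFin-finToFin {r} {2} i))
    (trans (funToFin-cong (λ p → fromBit-injective (equal _ _ (¬-not (none ∘ (p ,_))))))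
           (funToFin-finToFin {r} {2} j))) i≢j
  where
  equal : ∀ x y → x xor y ≡ false → x ≡ y
  equal false false _ = refl
  equal true  true  _ = refl

module _ {n : ℕ} where

  open import Data.List.Membership.DecPropositional (_≟_ {n}) using (_∈?_)

  spread : (cs : List (Fin n)) → (Fin (length cs) → Bool) → Fin n → Bool
  spread cs β v with v ∈? cs
  ... | yes v∈cs = β (index v∈cs)
  ... | no  _    = false

  spread-∉ : ∀ cs β {v} → ¬ (v ∈ cs) → spread cs β v ≡ false
  spread-∉ cs β {v} v∉cs with v ∈? cs
  ... | yes v∈cs = contradiction v∈cs v∉cs
  ... | no  _    = refl

  spread-lookup : ∀ {cs} → Unique cs → ∀ β i → spread cs β (lookup cs i) ≡ β i
  spread-lookup {cs} u β i with lookup cs i ∈? cs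
  ... | yes p = cong β (lookup-injective u (sym (lookup-index p)))
  ... | no ∉  = contradiction (∈-lookup i) ∉

  -- More columns than rows: two of the 2^|cs| combinations of columns have equal images.
  dependent : ∀ (M : Fin n → Fin n → Bool) ws {cs} → Unique cs → length ws < length cs →
              ∃[ x ] ((∀ v → ¬ (v ∈ cs) → x v ≡ false) × (∃[ v ] x v ≡ true) ×
                      (∀ {w} → w ∈ ws → M w ∙ x ≡ false))
  dependent M ws {cs} u ws<cs
    with pigeonhole (ℕ.^-monoʳ-< 2 (s≤s (s≤s z≤n)) ws<cs)
           (λ i → encode (λ j → M (lookup ws j) ∙ spread cs (decode {length cs} i)))
  ... | i , j , i<j , eq = (x i ⊕ x j) , off , nonzero , killed
    where
    x : Fin (2 ^ length cs) → Fin n → Bool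
    x i = spread cs (decode {length cs} i)
    off : ∀ v → ¬ (v ∈ cs) → (x i ⊕ x j) v ≡ false
    off v v∉cs = cong₂ _xor_ (spread-∉ cs _ v∉cs) (spread-∉ cs _ v∉cs)
    nonzero : ∃[ v ] (x i ⊕ x j) v ≡ true
    nonzero with p , d ← decode-differs {length cs} (<⇒≢ i<j) =
      lookup cs p , trans (cong₂ _xor_ (spread-lookup u _ p) (spread-lookup u _ p)) d
    killed : ∀ {w} → w ∈ ws → M w ∙ (x i ⊕ x j) ≡ false
    killed {w} w∈ws = trans (∙-⊕ʳ (M w) (x i) (x j))
      (trans (cong (_xor (M w ∙ x j)) (subst (λ w → M w ∙ x i ≡ M w ∙ x j) (sym (lookup-index w∈ws))
                                         (encode-injective eq (index w∈ws))))
             (xor-same (M w ∙ x j)))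

-- Vertices off a copy of P₃ + tP₁

pattern isolated i = suc (suc (suc i))

Copy : ∀ {n} → ℕ → Graph n → Set
Copy t A = Embedding (P₃+ t P₁) A

Outside : ∀ {n t} {A : Graph n} → Copy t A → Fin n → Set
Outside C v = ∀ i → to C i ≢ v

module _ {n t : ℕ} where

  -- Apart from `a ≢ c` and the injectivity of `I`, distinctness follows from the adjacencies.
  copy : ∀ {A : Graph n} (a b c : Fin n) (I : Fin t → Fin n) →
         adj A a b ≡ true → adj A b c ≡ true → adj A a c ≡ false → a ≢ c →
         Injective _≡_ _≡_ I → (∀ i → adj A (I i) a ≡ false) → (∀ i → adj A (I i) b ≡ false) →
         (∀ i → adj A (I i) c ≡ false) → (∀ i j → adj A (I i) (I j) ≡ false) → Copy t A
  copy {A} a b c I ab bc ac a≢c I-inj Ia Ib Ic II = record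
    { to = φ ; injective = λ {x} {y} → φ-inj x y ; preserves = φ-adj }
    where
    φ : Fin (3 + t) → Fin n
    φ 0F           = a
    φ 1F           = b
    φ 2F           = c
    φ (isolated i) = I i

    cb : adj A c b ≡ true
    cb = trans (adj-sym A c b) bc

    φ-inj : ∀ x y → φ x ≡ φ y → x ≡ y
    φ-inj 0F 0F _ = refl
    φ-inj 0F 1F eq = contradiction eq (adj⇒≢ A ab)
    φ-inj 0F 2F eq = contradiction eq a≢c
    φ-inj 0F (isolated j) eq = false≢true (Ib j) (subst (λ v → adj A v b ≡ true) eq ab)
    φ-inj 1F 0F eq = contradiction (sym eq) (adj⇒≢ A ab)
    φ-inj 1F 1F _ = refl
    φ-inj 1F 2F eq = contradiction eq (adj⇒≢ A bc)
    φ-inj 1F (isolated j) eq = false≢true (Ic j) (subst (λ v → adj A v c ≡ true) eq bc)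
    φ-inj 2F 0F eq = contradiction (sym eq) a≢c
    φ-inj 2F 1F eq = contradiction (sym eq) (adj⇒≢ A bc)
    φ-inj 2F 2F _ = refl
    φ-inj 2F (isolated j) eq = false≢true (Ib j) (subst (λ v → adj A v b ≡ true) eq cb)
    φ-inj (isolated i) 0F eq = false≢true (Ib i) (subst (λ v → adj A v b ≡ true) (sym eq) ab)
    φ-inj (isolated i) 1F eq = false≢true (Ic i) (subst (λ v → adj A v c ≡ true) (sym eq) bc)
    φ-inj (isolated i) 2F eq = false≢true (Ib i) (subst (λ v → adj A v b ≡ true) (sym eq) cb)
    φ-inj (isolated i) (isolated j) eq = cong (λ k → isolated k) (I-inj eq)

    φ-adj : ∀ x y → adj (P₃+ t P₁) x y ≡ adj A (φ x) (φ y)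
    φ-adj 0F 0F = sym (adj-irr A a)
    φ-adj 0F 1F = sym ab
    φ-adj 0F 2F = sym ac
    φ-adj 0F (isolated j) = sym (trans (adj-sym A a _) (Ia j))
    φ-adj 1F 0F = sym (trans (adj-sym A b a) ab)
    φ-adj 1F 1F = sym (adj-irr A b)
    φ-adj 1F 2F = sym bc
    φ-adj 1F (isolated j) = sym (trans (adj-sym A b _) (Ib j))
    φ-adj 2F 0F = sym (trans (adj-sym A c a) ac)
    φ-adj 2F 1F = sym cb
    φ-adj 2F 2F = sym (adj-irr A c)
    φ-adj 2F (isolated j) = sym (trans (adj-sym A c _) (Ic j))
    φ-adj (isolated i) 0F = sym (Ia i)
    φ-adj (isolated i) 1F = sym (Ib i)
    φ-adj (isolated i) 2F = sym (Ic i)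
    φ-adj (isolated i) (isolated j) = sym (II i j)

  reversed : ∀ {A : Graph n} → Copy t A → Copy t A
  reversed {A} C = copy (to C 2F) (to C 1F) (to C 0F) (λ i → to C (isolated i))
    (sym (preserves C 2F 1F)) (sym (preserves C 1F 0F)) (sym (preserves C 2F 0F))
    (λ eq → contradiction (injective C eq) λ ())
    (λ eq → suc-injective (suc-injective (suc-injective (injective C eq))))
    (λ i → sym (preserves C (isolated i) 2F)) (λ i → sym (preserves C (isolated i) 1F))
    (λ i → sym (preserves C (isolated i) 0F)) (λ i j → sym (preserves C (isolated i) (isolated j)))

  avoids : ∀ {A : Graph n} (C : Copy t A) {v} → to C 0F ≢ v → to C 1F ≢ v → to C 2F ≢ v →
            (∀ i → to C (isolated i) ≢ v) → Outside C v
  avoids C p q r s 0F = p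
  avoids C p q r s 1F = q
  avoids C p q r s 2F = r
  avoids C p q r s (isolated i) = s i

-- These two bits of p and q determine the effect of pivoting on u v on the pair p q.
Trace : ∀ {n} → Graph n → Fin n → Fin n → Fin n → Bool → Bool → Set
Trace A u v p x y = closed A u p ≡ x × closed A v p ≡ y

module _ {n} (A : Graph n) {u v : Fin n} (uv : Adjacent A u v) where

  pivot-trace : ∀ {p q k x y z w} → adj A p q ≡ k → Trace A u v p x y → Trace A u v q z w →
                adj (pivot A u v uv) p q ≡ k xor ((x ∧ w) xor (y ∧ z))
  pivot-trace {p} {q} refl (refl , refl) (refl , refl) = pivot-adj A u v uv p q

  trace : ∀ {p x y} → u ≢ p → v ≢ p → adj A u p ≡ x → adj A v p ≡ y → Trace A u v p x y
  trace u≢p v≢p up vp = trans (closed-≢ A u≢p) up , trans (closed-≢ A v≢p) vp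

  trace-v : Trace A u v v true true
  trace-v = closed-adj A uv , closed-refl A v

module Positions {n t : ℕ} {A : Graph n} (C : Copy t A) where

  a b c : Fin n
  a = to C 0F
  b = to C 1F
  c = to C 2F

  I : Fin t → Fin n
  I i = to C (isolated i)

  ab : adj A a b ≡ true
  ab = sym (preserves C 0F 1F)
  ba : adj A b a ≡ true
  ba = sym (preserves C 1F 0F)
  bc : adj A b c ≡ true
  bc = sym (preserves C 1F 2F)
  cb : adj A c b ≡ true
  cb = sym (preserves C 2F 1F)
  ac : adj A a c ≡ false
  ac = sym (preserves C 0F 2F)
  ca : adj A c a ≡ false
  ca = sym (preserves C 2F 0F)

  a≢b : a ≢ b
  a≢b = adj⇒≢ A ab
  a≢c : a ≢ c
  a≢c eq = contradiction (injective C eq) λ ()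
  b≢c : b ≢ c
  b≢c = adj⇒≢ A bc

  φ≢I : ∀ {x} i → x ≢ isolated i → to C x ≢ I i
  φ≢I i x≢ eq = x≢ (injective C eq)
  a≢I : ∀ i → a ≢ I i
  a≢I i = φ≢I i λ ()
  b≢I : ∀ i → b ≢ I i
  b≢I i = φ≢I i λ ()
  c≢I : ∀ i → c ≢ I i
  c≢I i = φ≢I i λ ()
  I-inj : Injective _≡_ _≡_ I
  I-inj eq = suc-injective (suc-injective (suc-injective (injective C eq)))

  Iφ : ∀ i x → adj A (I i) (to C x) ≡ false
  Iφ i x = trans (sym (preserves C (isolated i) x)) (iso-row i x)
    where
    iso-row : ∀ i x → adj (P₃+ t P₁) (isolated i) x ≡ false
    iso-row i 0F = refl
    iso-row i 1F = refl
    iso-row i 2F = refl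
    iso-row i (isolated j) = refl
  φI : ∀ x i → adj A (to C x) (I i) ≡ false
  φI x i = trans (adj-sym A _ _) (Iφ i x)

AtMiddle : ∀ {n t} {A : Graph n} → Copy t A → Fin n → Set
AtMiddle {A = A} C l = ∀ x → adj A l (to C x) ≡ δ 1F x

reverse-outside : ∀ {n t} {A : Graph n} (C : Copy t A) {v} → Outside C v → Outside (reversed C) v
reverse-outside C v∉C = avoids (reversed C) (v∉C 2F) (v∉C 1F) (v∉C 0F) (λ i → v∉C (isolated i))

another : ∀ {t} → 1 ≤ t → Σ[ j ∈ Fin (suc t) ] zero ≢ j
another (s≤s _) = suc zero , λ ()

-- Neighbourhoods excluded by minimality

module Minimal {n t : ℕ} {G : Graph n} (minimal : MinimalWithPivotMinor G (P₃+ t P₁)) where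

  module _ {A : Graph n} {X : Fin n → Bool} (AG : PPT A X G) where

    inside-X : ∀ (C : Copy t A) {v} → Outside C v → X v ≡ true
    inside-X C v∉C = minimal⇒inside minimal AG C _ v∉C

    -- Pivoting on u v moves u out of X.
    no-copy-after-pivot : ∀ {u v} (uv : Adjacent A u v) → X u ≡ true →
                          (C : Copy t (pivot A u v uv)) → to C 0F ≢ u → to C 1F ≢ u → to C 2F ≢ u →
                          ¬ (∀ i → to C (isolated i) ≢ u)
    no-copy-after-pivot {u} {v} uv Xu C p q r s =
      false≢true moved (minimal⇒inside minimal (ppt-∘ (ppt-unpivot A u v uv) AG) C u (avoids C p q r s))
      where
      moved : (pair u v ⊕ X) u ≡ false
      moved rewrite δ-refl u | δ-≢ (adj⇒≢ A (trans (adj-sym A v u) uv)) | Xu = refl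

    -- The pivot does not affect membership of `z` in the set. This serves when the vertex one would
    -- like to move out of `X` is already outside it.
    no-copy-after-pivot-elsewhere :
      ∀ {u v z} (uv : Adjacent A u v) → u ≢ z → v ≢ z → X z ≡ false →
      (C : Copy t (pivot A u v uv)) → to C 0F ≢ z → to C 1F ≢ z → to C 2F ≢ z →
      ¬ (∀ i → to C (isolated i) ≢ z)
    no-copy-after-pivot-elsewhere {u} {v} {z} uv u≢z v≢z Xz C p q r s =
      false≢true kept (minimal⇒inside minimal (ppt-∘ (ppt-unpivot A u v uv) AG) C z (avoids C p q r s))
      where
      kept : (pair u v ⊕ X) z ≡ false
      kept rewrite δ-≢ u≢z | δ-≢ v≢z = Xz

    -- The first trace bit is `false` on the whole copy, so all determinants vanish and the copy
    -- survives the pivot that takes `u` out of `X`.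
    copy-unchanged : ∀ (C : Copy t A) {u v} → Outside C u → Outside C v → Adjacent A u v →
                     ¬ (∀ x → adj A u (to C x) ≡ false)
    copy-unchanged C {u} {v} u∉C v∉C uv uC≡0 = no-copy-after-pivot uv (inside-X C u∉C)
      record { to = to C ; injective = injective C ; preserves = λ x y →
        trans (preserves C x y) (sym (unchanged x y)) } (u∉C 0F) (u∉C 1F) (u∉C 2F) (λ i → u∉C (isolated i))
      where
      tr : ∀ x → Trace A u v (to C x) false (adj A v (to C x))
      tr x = trace A uv (u∉C x ∘ sym) (v∉C x ∘ sym) (uC≡0 x) refl
      unchanged : ∀ x y → adj (pivot A u v uv) (to C x) (to C y) ≡ adj A (to C x) (to C y)
      unchanged x y = trans (pivot-trace A uv refl (tr x) (tr y))
        (truthTable 2 (λ k m → k xor (false xor (m ∧ false))) (λ k m → k) refl _ (adj A v (to C x)))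

    module _ (C : Copy t A) where

      open Positions C

      -- As `w` lies in `X`, it has a neighbour in `X`, necessarily off the copy; `copy-unchanged`
      -- applies to that edge.
      not-isolated : ∀ {w} → Outside C w → ¬ (∀ x → adj A w (to C x) ≡ false)
      not-isolated {w} w∉C wC≡0 with v , Xv , wv ← neighbour-in AG w (inside-X C w∉C) =
        copy-unchanged C w∉C (λ { x refl → false≢true (wC≡0 x) wv }) wv wC≡0

      -- On an edge between twins, both trace bits coincide at every vertex of the copy, so pivoting
      -- there would leave the copy intact.
      twins-nonadjacent : ∀ {u v} → Outside C u → Outside C v →
                          (∀ x → adj A u (to C x) ≡ adj A v (to C x)) → adj A u v ≡ false
      twins-nonadjacent {u} {v} u∉C v∉C same = ¬-not λ uv →
        no-copy-after-pivot uv (inside-X C u∉C)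
          record { to = to C ; injective = injective C ; preserves = λ x y →
            trans (preserves C x y) (sym (unchanged uv x y)) } (u∉C 0F) (u∉C 1F) (u∉C 2F) (λ i → u∉C (isolated i))
        where
        tr : ∀ uv x → Trace A u v (to C x) (adj A u (to C x)) (adj A u (to C x))
        tr uv x = trace A uv (u∉C x ∘ sym) (v∉C x ∘ sym) refl (sym (same x))
        unchanged : ∀ uv x y → adj (pivot A u v uv) (to C x) (to C y) ≡ adj A (to C x) (to C y)
        unchanged uv x y = trans (pivot-trace A uv refl (tr uv x) (tr uv y))
          (truthTable 3 (λ k m l → k xor ((m ∧ l) xor (m ∧ l))) (λ k m l → k) refl
            _ (adj A u (to C x)) (adj A u (to C y)))

      module _ {w : Fin n} (w∉C : Outside C w) (wI : ∀ i → adj A w (I i) ≡ false) where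

        private
          φ≢w : ∀ x → w ≢ to C x
          φ≢w x eq = w∉C x (sym eq)

        -- In the pivot on `w a`, the vertices `a` and `b` have equal traces and the others zero
        -- traces, so the copy itself survives.
        not-end-and-middle : adj A w a ≡ true → adj A w b ≡ true → ¬ adj A w c ≡ false
        not-end-and-middle wa wb wc = no-copy-after-pivot wa (inside-X C w∉C)
          (copy a b c I (pivot-trace A wa ab tra trb) (pivot-trace A wa bc trb trc)
            (pivot-trace A wa ac tra trc) a≢c I-inj
            (λ i → pivot-trace A wa (Iφ i 0F) (trI i) tra) (λ i → pivot-trace A wa (Iφ i 1F) (trI i) trb)
            (λ i → pivot-trace A wa (Iφ i 2F) (trI i) trc)
            (λ i j → pivot-trace A wa (Iφ i (isolated j)) (trI i) (trI j)))
          (w∉C 0F) (w∉C 1F) (w∉C 2F) (λ i → w∉C (isolated i))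
          where
          tra : Trace A w a a true true
          tra = trace-v A wa
          trb : Trace A w a b true true
          trb = trace A wa (φ≢w 1F) a≢b wb ab
          trc : Trace A w a c false false
          trc = trace A wa (φ≢w 2F) a≢c wc ac
          trI : ∀ i → Trace A w a (I i) false false
          trI i = trace A wa (φ≢w _) (a≢I i) (wI i) (φI 0F i)

        -- The pivot on `w a` toggles exactly `a c` and `b c` within the copy, turning the path into
        -- `b` - `a` - `c`.
        not-whole-path : adj A w a ≡ true → adj A w b ≡ true → ¬ adj A w c ≡ true
        not-whole-path wa wb wc = no-copy-after-pivot wa (inside-X C w∉C)
          (copy b a c I (pivot-trace A wa ba trb tra) (pivot-trace A wa ac tra trc)
            (pivot-trace A wa bc trb trc) b≢c I-inj
            (λ i → pivot-trace A wa (Iφ i 1F) (trI i) trb) (λ i → pivot-trace A wa (Iφ i 0F) (trI i) tra)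
            (λ i → pivot-trace A wa (Iφ i 2F) (trI i) trc)
            (λ i j → pivot-trace A wa (Iφ i (isolated j)) (trI i) (trI j)))
          (w∉C 1F) (w∉C 0F) (w∉C 2F) (λ i → w∉C (isolated i))
          where
          tra : Trace A w a a true true
          tra = trace-v A wa
          trb : Trace A w a b true true
          trb = trace A wa (φ≢w 1F) a≢b wb ab
          trc : Trace A w a c true false
          trc = trace A wa (φ≢w 2F) a≢c wc ac
          trI : ∀ i → Trace A w a (I i) false false
          trI i = trace A wa (φ≢w _) (a≢I i) (wI i) (φI 0F i)

        -- Pivoting on `a w` puts `w` in the place of `a`, giving a copy that avoids `a`.
        pendant-at-end : adj A w a ≡ true → adj A w b ≡ false → adj A w c ≡ false → X a ≡ false
        pendant-at-end wa wb wc = ¬-not λ Xa → no-copy-after-pivot aw Xa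
          (copy w b c I (pivot-trace A aw wb trw trb) (pivot-trace A aw bc trb trc)
            (pivot-trace A aw wc trw trc) (φ≢w 2F) I-inj
            (λ i → pivot-trace A aw (trans (adj-sym A _ w) (wI i)) (trI i) trw)
            (λ i → pivot-trace A aw (Iφ i 1F) (trI i) trb)
            (λ i → pivot-trace A aw (Iφ i 2F) (trI i) trc)
            (λ i j → pivot-trace A aw (Iφ i (isolated j)) (trI i) (trI j)))
          (φ≢w 0F) (a≢b ∘ sym) (a≢c ∘ sym) (λ i → a≢I i ∘ sym)
          where
          aw : adj A a w ≡ true
          aw = trans (adj-sym A a w) wa
          trw : Trace A a w w true true
          trw = trace-v A aw
          trb : Trace A a w b true false
          trb = trace A aw a≢b (φ≢w 1F) ab wb
          trc : Trace A a w c false false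
          trc = trace A aw a≢c (φ≢w 2F) ac wc
          trI : ∀ i → Trace A a w (I i) false false
          trI i = trace A aw (a≢I i) (φ≢w _) (φI 0F i) (wI i)

        -- The same exchange, with `w` in the place of `b`. It yields no contradiction, but its
        -- conclusion is what the rank bound on leaves needs.
        pendant-at-middle : adj A w a ≡ false → adj A w b ≡ true → adj A w c ≡ false → X b ≡ false
        pendant-at-middle wa wb wc = ¬-not λ Xb → no-copy-after-pivot bw Xb
          (copy a w c I (pivot-trace A bw (trans (adj-sym A a w) wa) tra trw) (pivot-trace A bw wc trw trc)
            (pivot-trace A bw ac tra trc) a≢c I-inj
            (λ i → pivot-trace A bw (Iφ i 0F) (trI i) tra)
            (λ i → pivot-trace A bw (trans (adj-sym A _ w) (wI i)) (trI i) trw)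
            (λ i → pivot-trace A bw (Iφ i 2F) (trI i) trc)
            (λ i j → pivot-trace A bw (Iφ i (isolated j)) (trI i) (trI j)))
          a≢b (φ≢w 1F) (b≢c ∘ sym) (λ i → b≢I i ∘ sym)
          where
          bw : adj A b w ≡ true
          bw = trans (adj-sym A b w) wb
          trw : Trace A b w w true true
          trw = trace-v A bw
          tra : Trace A b w a true false
          tra = trace A bw (a≢b ∘ sym) (φ≢w 0F) ba wa
          trc : Trace A b w c true false
          trc = trace A bw b≢c (φ≢w 2F) bc wc
          trI : ∀ i → Trace A b w (I i) false false
          trI i = trace A bw (b≢I i) (φ≢w _) (φI 1F i) (wI i)

      module _ {w z : Fin n} (w∉C : Outside C w) (z∉C : Outside C z) (w≢z : w ≢ z)
               (wz : adj A w z ≡ false)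
               (wI : ∀ i → adj A w (I i) ≡ false) (zI : ∀ i → adj A z (I i) ≡ false) where

        private
          Iw : ∀ i → adj A (I i) w ≡ false
          Iw i = trans (adj-sym A (I i) w) (wI i)
          Iz : ∀ i → adj A (I i) z ≡ false
          Iz i = trans (adj-sym A (I i) z) (zI i)

        -- After the pivot `w` is adjacent to the former neighbours `b` and `z` of `a`, which remain
        -- nonadjacent. The path is in fact entered as `b` - `w` - `z`, avoiding both `a` and `c`.
        square-copy : (aw : adj A a w ≡ true) → adj A a z ≡ true → adj A w b ≡ false → adj A z b ≡ false →
                      Copy t (pivot A a w aw)
        square-copy aw az wb zb = copy b w z I
            (pivot-trace A aw (trans (adj-sym A b w) wb) trb trw)
            (pivot-trace A aw wz trw trz)
            (pivot-trace A aw (trans (adj-sym A b z) zb) trb trz) (z∉C 1F) I-inj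
            (λ i → pivot-trace A aw (Iφ i 1F) (trI i) trb)
            (λ i → pivot-trace A aw (Iw i) (trI i) trw)
            (λ i → pivot-trace A aw (Iz i) (trI i) trz)
            (λ i j → pivot-trace A aw (Iφ i (isolated j)) (trI i) (trI j))
          where
          trw : Trace A a w w true true
          trw = trace-v A aw
          trb : Trace A a w b true false
          trb = trace A aw a≢b (w∉C 1F ∘ sym) ab wb
          trz : Trace A a w z true false
          trz = trace A aw (z∉C 0F) w≢z az wz
          trI : ∀ i → Trace A a w (I i) false false
          trI i = trace A aw (a≢I i) (w∉C _ ∘ sym) (φI 0F i) (wI i)

        -- Re-centring to the path `w` - `a` - `z` leaves `c` without neighbours on the copy, while
        -- its neighbour `b` is also off it.
        not-two-pendants : adj A w a ≡ true → adj A z a ≡ true → adj A w b ≡ false → adj A z b ≡ false →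
                           adj A w c ≡ false → ¬ adj A z c ≡ false
        not-two-pendants wa za wb zb wc zc = copy-unchanged C′ c∉C′ b∉C′ cb c-row
          where
          C′ : Copy t A
          C′ = copy w a z I wa (trans (adj-sym A a z) za) wz w≢z I-inj Iw (λ i → Iφ i 0F) Iz
                 (λ i j → Iφ i (isolated j))
          b∉C′ : Outside C′ b
          b∉C′ = avoids C′ (w∉C 1F ∘ sym) a≢b (z∉C 1F ∘ sym) (λ i → b≢I i ∘ sym)
          c∉C′ : Outside C′ c
          c∉C′ = avoids C′ (w∉C 2F ∘ sym) a≢c (z∉C 2F ∘ sym) (λ i → c≢I i ∘ sym)
          c-row : ∀ x → adj A c (to C′ x) ≡ false
          c-row 0F = trans (adj-sym A c w) wc
          c-row 1F = ca
          c-row 2F = trans (adj-sym A c z) zc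
          c-row (isolated i) = φI 2F i

      -- Pivoting on w 0 and I i isolates the other w j.
      few-at-isolated : (w : Fin (suc t) → Fin n) → Injective _≡_ _≡_ w → (∀ j → Outside C (w j)) →
                        (∀ j x → adj A (w j) (to C x) ≡ adj A (w zero) (to C x)) →
                        ∀ i → ¬ adj A (w zero) (I i) ≡ true
      few-at-isolated w w-inj w∉C same i w₀i = no-copy-after-pivot w₀i (inside-X C (w∉C zero))
        (copy a b c (w ∘ suc) (pivot-path 0F 1F a≢I b≢I ab) (pivot-path 1F 2F b≢I c≢I bc)
          (pivot-path 0F 2F a≢I c≢I ac) a≢c (suc-injective ∘ w-inj)
          (λ j → pivot-leaf j 0F a≢I) (λ j → pivot-leaf j 1F b≢I) (λ j → pivot-leaf j 2F c≢I)
          (λ j k → pivot-trace A w₀i (nonadjacent (suc j) (suc k)) (tr-leaf j) (tr-leaf k)))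
        (w∉C zero 0F) (w∉C zero 1F) (w∉C zero 2F) (λ j eq → contradiction (w-inj eq) λ ())
        where
        nonadjacent : ∀ j k → adj A (w j) (w k) ≡ false
        nonadjacent j k = twins-nonadjacent (w∉C j) (w∉C k) (λ x → trans (same j x) (sym (same k x)))
        tr : ∀ x → (∀ i → to C x ≢ I i) → Trace A (w zero) (I i) (to C x) (adj A (w zero) (to C x)) false
        tr x x≢I = trace A w₀i (w∉C zero x ∘ sym) (x≢I i ∘ sym) refl (Iφ i x)
        tr-leaf : ∀ j → Trace A (w zero) (I i) (w (suc j)) false true
        tr-leaf j = trace A w₀i (λ eq → contradiction (w-inj eq) λ ()) (w∉C (suc j) _)
          (nonadjacent zero (suc j)) (trans (adj-sym A _ _) (trans (same (suc j) (isolated i)) w₀i))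
        pivot-path : ∀ x y → (∀ i → to C x ≢ I i) → (∀ i → to C y ≢ I i) → ∀ {k} →
                     adj A (to C x) (to C y) ≡ k → adj (pivot A (w zero) (I i) w₀i) (to C x) (to C y) ≡ k
        pivot-path x y x≢I y≢I {k} xy = trans (pivot-trace A w₀i xy (tr x x≢I) (tr y y≢I))
          (truthTable 2 (λ k m → k xor ((m ∧ false) xor false)) (λ k m → k) refl k (adj A (w zero) (to C x)))
        pivot-leaf : ∀ j x → (∀ i → to C x ≢ I i) →
                     adj (pivot A (w zero) (I i) w₀i) (w (suc j)) (to C x) ≡ false
        pivot-leaf j x x≢I = trans (pivot-trace A w₀i (same (suc j) x) (tr-leaf j) (tr x x≢I))
          (xor-same (adj A (w zero) (to C x)))

    -- The pivot may start at either end of the path, and both resulting copies avoid `a`; the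
    -- choice depends on whether `a` lies in `X`.
    not-two-squares : ∀ (C : Copy t A) {w z} → Outside C w → Outside C z → w ≢ z → adj A w z ≡ false →
                      (∀ i → adj A w (to C (isolated i)) ≡ false) →
                      (∀ i → adj A z (to C (isolated i)) ≡ false) →
                      adj A w (to C 0F) ≡ true → adj A z (to C 0F) ≡ true →
                      adj A w (to C 1F) ≡ false → adj A z (to C 1F) ≡ false →
                      adj A w (to C 2F) ≡ true → ¬ adj A z (to C 2F) ≡ true
    not-two-squares C {w} {z} w∉C z∉C w≢z wz wI zI wa za wb zb wc zc with X (to C 0F) in Xa
    ... | true = no-copy-after-pivot aw Xa
      (square-copy C w∉C z∉C w≢z wz wI zI aw (trans (adj-sym A a z) za) wb zb)
      (a≢b ∘ sym) (w∉C 0F ∘ sym) (z∉C 0F ∘ sym) (λ i → a≢I i ∘ sym)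
      where
      open Positions C
      aw : adj A a w ≡ true
      aw = trans (adj-sym A a w) wa
    -- Here `a` is not an end of the pivoted edge `c w`, so it stays outside the set, yet the
    -- mirrored copy misses it.
    ... | false = no-copy-after-pivot-elsewhere cw (a≢c ∘ sym) (w∉C 0F ∘ sym) Xa
      (square-copy (reversed C) (reverse-outside C w∉C) (reverse-outside C z∉C) w≢z wz wI zI cw
        (trans (adj-sym A c z) zc) wb zb)
      (a≢b ∘ sym) (w∉C 0F ∘ sym) (z∉C 0F ∘ sym) (λ i → a≢I i ∘ sym)
      where
      open Positions C
      cw : adj A c w ≡ true
      cw = trans (adj-sym A c w) wc

    -- All `suc t` vertices are needed only when the neighbourhood meets `I`. Otherwise two suffice,
    -- the second existing because `1 ≤ t`; the empty neighbourhood and those containing `b` and an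
    -- end of the path are impossible even for a single vertex.
    few-twins : 1 ≤ t → ∀ (C : Copy t A) (w : Fin (suc t) → Fin n) → Injective _≡_ _≡_ w →
                (∀ j → Outside C (w j)) → (∀ j x → adj A (w j) (to C x) ≡ adj A (w zero) (to C x)) →
                AtMiddle C (w zero)
    few-twins 1≤t C w w-inj w∉C same with any? (λ i → adj A (w zero) (to C (isolated i)) Bool.≟ true)
    ... | yes (i , w₀i) = ⊥-elim (few-at-isolated C w w-inj w∉C same i w₀i)
    ... | no  none = by-ends _ _ _ refl refl refl
      where
      open Positions C
      w₀ w₁ : Fin n
      w₀ = w zero
      w₁ = w (proj₁ (another 1≤t))
      same₁ : ∀ {k} x → adj A w₀ (to C x) ≡ k → adj A w₁ (to C x) ≡ k
      same₁ x = trans (same _ x)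
      w₀I : ∀ i → adj A w₀ (I i) ≡ false
      w₀I i = ¬-not (none ∘ (i ,_))
      w₁I : ∀ i → adj A w₁ (I i) ≡ false
      w₁I i = same₁ _ (w₀I i)
      w₀∉C = w∉C zero
      w₁∉C = w∉C (proj₁ (another 1≤t))
      w₀≢w₁ : w₀ ≢ w₁
      w₀≢w₁ = proj₂ (another 1≤t) ∘ w-inj
      w₀w₁ : adj A w₀ w₁ ≡ false
      w₀w₁ = twins-nonadjacent C w₀∉C w₁∉C (λ x → sym (same _ x))

      by-ends : ∀ p q r → adj A w₀ a ≡ p → adj A w₀ b ≡ q → adj A w₀ c ≡ r → AtMiddle C w₀
      by-ends false false false p q r = ⊥-elim (not-isolated C w₀∉C λ
        { 0F → p ; 1F → q ; 2F → r ; (isolated i) → w₀I i })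
      by-ends false false true  p q r = ⊥-elim (not-two-pendants (reversed C) (reverse-outside C w₀∉C)
        (reverse-outside C w₁∉C) w₀≢w₁ w₀w₁ w₀I w₁I r (same₁ 2F r) q (same₁ 1F q) p (same₁ 0F p))
      by-ends false true  false p q r = λ { 0F → p ; 1F → q ; 2F → r ; (isolated i) → w₀I i }
      by-ends false true  true  p q r =
        ⊥-elim (not-end-and-middle (reversed C) (reverse-outside C w₀∉C) w₀I r q p)
      by-ends true  false false p q r = ⊥-elim (not-two-pendants C w₀∉C w₁∉C w₀≢w₁ w₀w₁ w₀I w₁I
        p (same₁ 0F p) q (same₁ 1F q) r (same₁ 2F r))
      by-ends true  false true  p q r = ⊥-elim (not-two-squares C w₀∉C w₁∉C w₀≢w₁ w₀w₁ w₀I w₁I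
        p (same₁ 0F p) q (same₁ 1F q) r (same₁ 2F r))
      by-ends true  true  false p q r = ⊥-elim (not-end-and-middle C w₀∉C w₀I p q r)
      by-ends true  true  true  p q r = ⊥-elim (not-whole-path C w₀∉C w₀I p q r)

    -- Leaves and re-centred copies

    module Leaves (1≤t : 1 ≤ t) (C : Copy t A) where

      open Positions C

      Leaf : Fin n → Set
      Leaf l = Outside C l × AtMiddle C l

      recentred : ∀ {x y} → adj A x b ≡ true → adj A y b ≡ true → adj A x y ≡ false → x ≢ y →
                  (∀ i → adj A x (I i) ≡ false) → (∀ i → adj A y (I i) ≡ false) → Copy t A
      recentred {x} {y} xb yb xy x≢y xI yI = copy x b y I xb (trans (adj-sym A b y) yb) xy x≢y I-inj
        (λ i → trans (adj-sym A _ x) (xI i)) (λ i → Iφ i 1F) (λ i → trans (adj-sym A _ y) (yI i))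
        (λ i j → Iφ i (isolated j))

      leaves-nonadjacent : ∀ {l m} → Leaf l → Leaf m → adj A l m ≡ false
      leaves-nonadjacent (l∉C , lC) (m∉C , mC) =
        twins-nonadjacent C l∉C m∉C (λ x → trans (lC x) (sym (mC x)))

      leaf-copy : ∀ {l m} → Leaf l → Leaf m → l ≢ m → Copy t A
      leaf-copy lL@(_ , lC) mL@(_ , mC) l≢m =
        recentred (lC 1F) (mC 1F) (leaves-nonadjacent lL mL) l≢m (λ i → lC (isolated i)) (λ i → mC (isolated i))

      -- Pivoting on w and g 0 isolates the other g j and makes I i - b - l a path.
      few-leaf-neighbours : (g : Fin (suc t) → Fin n) → Injective _≡_ _≡_ g → (∀ j → Leaf (g j)) →
                            ∀ {l w i} → Leaf l → Outside C w → (∀ j → adj A w (g j) ≡ true) →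
                            adj A w l ≡ false → ¬ adj A w (I i) ≡ true
      few-leaf-neighbours g g-inj gL {l} {w} {i} lL@(l∉C , lC) w∉C wg wl wi =
        no-copy-after-pivot uw (inside-X C (proj₁ (gL zero)))
          (copy (I i) b l (g ∘ suc) (pivot-trace A uw (Iφ i 1F) tri trb)
            (trans (adj-sym (pivot A u w uw) b l) (pivot-trace A uw (lC 1F) trl trb))
            (pivot-trace A uw (trans (adj-sym A _ l) (lC (isolated i))) tri trl)
            (l∉C (isolated i)) (suc-injective ∘ g-inj)
            (λ j → pivot-trace A uw (proj₂ (gL (suc j)) (isolated i)) (trg j) tri)
            (λ j → pivot-trace A uw (proj₂ (gL (suc j)) 1F) (trg j) trb)
            (λ j → pivot-trace A uw (leaves-nonadjacent (gL (suc j)) lL) (trg j) trl)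
            (λ j k → pivot-trace A uw (leaves-nonadjacent (gL (suc j)) (gL (suc k))) (trg j) (trg k)))
          (proj₁ (gL zero) _) (proj₁ (gL zero) _) l≢u (λ j eq → contradiction (g-inj eq) λ ())
        where
        u : Fin n
        u = g zero
        uw : adj A u w ≡ true
        uw = trans (adj-sym A u w) (wg zero)
        l≢u : l ≢ u
        l≢u refl = false≢true wl (wg zero)
        w≢l : w ≢ l
        w≢l refl = false≢true (leaves-nonadjacent (gL zero) lL) uw
        trb : Trace A u w b true (adj A w b)
        trb = trace A uw (proj₁ (gL zero) _ ∘ sym) (w∉C _ ∘ sym) (proj₂ (gL zero) 1F) refl
        trl : Trace A u w l false false
        trl = trace A uw (l≢u ∘ sym) w≢l (leaves-nonadjacent (gL zero) lL) wl
        tri : Trace A u w (I i) false true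
        tri = trace A uw (proj₁ (gL zero) _ ∘ sym) (w∉C _ ∘ sym) (proj₂ (gL zero) (isolated i)) wi
        trg : ∀ j → Trace A u w (g (suc j)) false true
        trg j = trace A uw (λ eq → contradiction (g-inj eq) λ ()) (adj⇒≢ A (wg (suc j)))
          (leaves-nonadjacent (gL zero) (gL (suc j))) (wg (suc j))

      -- If `w` missed `I`, the copy `m` - `b` - `l` would leave only adjacency to `b` and not to
      -- `m`. Then `a` - `b` - `l` and `c` - `b` - `l` exclude adjacency to `a` and `c`, making `w`
      -- a leaf.
      sees-isolated : ∀ {w l m} → Outside C w → ¬ AtMiddle C w → Leaf l → Leaf m → l ≢ m →
                      adj A w l ≡ false → ∃[ i ] adj A w (I i) ≡ true
      sees-isolated {w} {l} {m} w∉C w∉L lL@(l∉C , lC) mL@(m∉C , mC) l≢m wl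
        with any? (λ i → adj A w (I i) Bool.≟ true)
      ... | yes found = found
      ... | no  none  = ⊥-elim (by-bits _ _ refl refl)
        where
        wI : ∀ i → adj A w (I i) ≡ false
        wI i = ¬-not (none ∘ (i ,_))
        not-leaf : ∀ {z} → AtMiddle C z → z ≢ w
        not-leaf zC refl = w∉L zC

        D : Copy t A
        D = leaf-copy mL lL (l≢m ∘ sym)
        w∉D : Outside D w
        w∉D = avoids D (not-leaf mC) (w∉C 1F) (not-leaf lC) (λ i → w∉C (isolated i))

        Da Dc : Copy t A
        Da = recentred ab (lC 1F) (trans (adj-sym A a l) (lC 0F)) (l∉C 0F) (φI 0F) (λ i → lC (isolated i))
        Dc = recentred cb (lC 1F) (trans (adj-sym A c l) (lC 2F)) (l∉C 2F) (φI 2F) (λ i → lC (isolated i))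
        w∉Da : Outside Da w
        w∉Da = avoids Da (w∉C 0F) (w∉C 1F) (not-leaf lC) (λ i → w∉C (isolated i))
        w∉Dc : Outside Dc w
        w∉Dc = avoids Dc (w∉C 2F) (w∉C 1F) (not-leaf lC) (λ i → w∉C (isolated i))

        by-bits : ∀ p q → adj A w m ≡ p → adj A w b ≡ q → ⊥
        by-bits true  true  wm wb = not-end-and-middle D w∉D wI wm wb wl
        -- As an end of `D`, `m` is forced out of `X`; as a vertex off `C`, it lies in `X`.
        by-bits true  false wm wb = false≢true (pendant-at-end D w∉D wI wm wb wl) (inside-X C m∉C)
        by-bits false false wm wb = not-isolated D w∉D λ
          { 0F → wm ; 1F → wb ; 2F → wl ; (isolated i) → wI i }
        by-bits false true  wm wb = w∉L λ
          { 0F → ¬-not (λ wa → not-end-and-middle Da w∉Da wI wa wb wl) ; 1F → wb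
          ; 2F → ¬-not (λ wc → not-end-and-middle Dc w∉Dc wI wc wb wl) ; (isolated i) → wI i }

      -- Re-centring at two leaves on which the w j agree makes them twins.
      module _ {L : List (Fin n)} (unique : Unique L) (all-leaves : ∀ {l} → l ∈ L → Leaf l)
               (many : 2 + suc t * t ≤ length L)
               (w : Fin (suc t) → Fin n) (w-inj : Injective _≡_ _≡_ w)
               (w∉C : ∀ j → Outside C (w j)) (w∉L : ∀ j → ¬ AtMiddle C (w j))
               (same-b : ∀ j → adj A (w j) b ≡ adj A (w zero) b)
               (same-I : ∀ j i → adj A (w j) (I i) ≡ adj A (w zero) (I i)) where

        private
          outside-leaf-copy : ∀ {l m} (lL : Leaf l) (mL : Leaf m) (l≢m : l ≢ m) →
                              ∀ j → Outside (leaf-copy lL mL l≢m) (w j)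
          outside-leaf-copy lL mL l≢m j = avoids (leaf-copy lL mL l≢m) (not-leaf lL) (w∉C j 1F)
              (not-leaf mL) (λ i → w∉C j (isolated i))
            where
            not-leaf : ∀ {l} → Leaf l → l ≢ w j
            not-leaf (_ , lC) refl = w∉L j lC

          twins : ∀ {l m k} (lL : Leaf l) (mL : Leaf m) (l≢m : l ≢ m) →
                  (∀ j → adj A (w j) l ≡ k) → (∀ j → adj A (w j) m ≡ k) →
                  AtMiddle (leaf-copy lL mL l≢m) (w zero)
          twins lL mL l≢m wl wm = few-twins 1≤t (leaf-copy lL mL l≢m) w w-inj (outside-leaf-copy lL mL l≢m) λ
            { j 0F → trans (wl j) (sym (wl zero)) ; j 1F → same-b j
            ; j 2F → trans (wm j) (sym (wm zero)) ; j (isolated i) → same-I j i }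

        -- Any two leaves serve as new ends, and `few-twins` would then make `w zero` nonadjacent to
        -- them.
        not-all-full : ¬ (∀ j {l} → l ∈ L → adj A (w j) l ≡ true)
        not-all-full full with g , g-inj , g∈L ← choose 2 unique (ℕ.m+n≤o⇒m≤o 2 many) =
          false≢true (twins (all-leaves (g∈L 0F)) (all-leaves (g∈L 1F)) (λ eq → contradiction (g-inj eq) λ ())
            (λ j → full j (g∈L 0F)) (λ j → full j (g∈L 1F)) 0F) (full zero (g∈L 0F))

        -- Each `w j` misses a leaf, so it has a neighbour in `I`, and `few-leaf-neighbours` allows
        -- it at most `t` neighbours in `L`. At most `suc t * t` leaves are met in all, so `many`
        -- provides two missed by every `w j`. Re-centred there, `few-twins` denies `w zero` its
        -- neighbour in `I`.
        not-all-nonfull : ¬ (∀ j → ∃[ l ] (l ∈ L × adj A (w j) l ≡ false))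
        not-all-nonfull nonfull = contradict (choose 2 (filter⁺ missed? unique) two-missed)
          where
          missed? : Decidable (λ l → ∀ j → adj A (w j) l ≡ false)
          missed? l = all? (λ j → adj A (w j) l Bool.≟ false)

          another-leaf : ∀ l → ∃[ m ] (m ∈ L × l ≢ m)
          another-leaf l with g , g-inj , g∈L ← choose 2 unique (ℕ.m+n≤o⇒m≤o 2 many) | l ≟ g 0F
          ... | yes refl = g 1F , g∈L 1F , λ eq → contradiction (g-inj eq) λ ()
          ... | no  l≢g₀ = g 0F , g∈L 0F , l≢g₀

          seen : ∀ j → ∃[ i ] adj A (w j) (I i) ≡ true
          seen j = let l , l∈L , wl = nonfull j ; m , m∈L , l≢m = another-leaf l in
            sees-isolated (w∉C j) (w∉L j) (all-leaves l∈L) (all-leaves m∈L) l≢m wl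

          hit : Fin n → Fin (suc t)
          hit l with any? (λ j → adj A (w j) l Bool.≟ true)
          ... | yes (j , _) = j
          -- An arbitrary default: the count below concerns only leaves met by some `w j`.
          ... | no  _       = zero

          hit-adjacent : ∀ {l} → ¬ (∀ j → adj A (w j) l ≡ false) → adj A (w (hit l)) l ≡ true
          hit-adjacent {l} met with any? (λ j → adj A (w j) l Bool.≟ true)
          ... | yes (j , wl) = wl
          ... | no  none     = contradiction (λ j → ¬-not (none ∘ (j ,_))) met

          met≤ : length (filter (¬? ∘ missed?) L) ≤ suc t * t
          met≤ = length≤fibres (filter⁺ (¬? ∘ missed?) unique) (suc t) t (toℕ ∘ hit) (λ _ → toℕ<n _)
            λ g g-inj g∈ const →
              let met i = ∈-filter⁻ (¬? ∘ missed?) {xs = L} (g∈ i)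
                  j = hit (g zero)
                  l , l∈L , wl = nonfull j
              in few-leaf-neighbours g g-inj (λ i → all-leaves (proj₁ (met i))) (all-leaves l∈L) (w∉C j)
                   (λ i → subst (λ k → adj A (w k) (g i) ≡ true) (toℕ-injective (const i))
                      (hit-adjacent (proj₂ (met i))))
                   wl (proj₂ (seen j))

          two-missed : 2 ≤ length (filter missed? L)
          two-missed = ℕ.+-cancelʳ-≤ (suc t * t) 2 _ (ℕ.≤-trans many
            (ℕ.≤-trans (ℕ.≤-reflexive (length-filter-¬ missed? L)) (ℕ.+-monoʳ-≤ _ met≤)))

          contradict : ¬ (Σ[ g ∈ (Fin 2 → Fin n) ] (Injective _≡_ _≡_ g × (∀ i → g i ∈ filter missed? L)))
          contradict (g , g-inj , g∈missed) =
            false≢true (twins (leaf 0F) (leaf 1F) (λ eq → contradiction (g-inj eq) λ ()) (missed 0F) (missed 1F)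
              (isolated (proj₁ (seen zero)))) (proj₂ (seen zero))
            where
            leaf : ∀ i → Leaf (g i)
            leaf i = all-leaves (proj₁ (∈-filter⁻ missed? {xs = L} (g∈missed i)))
            missed : ∀ i j → adj A (w j) (g i) ≡ false
            missed i = proj₂ (∈-filter⁻ missed? {xs = L} (g∈missed i))

-- The bound

⌊⌋-true : ∀ {P : Set} (P? : Dec P) → ⌊ P? ⌋ ≡ true → P
⌊⌋-true (yes p) _ = p

⌊⌋-false : ∀ {P : Set} (P? : Dec P) → ⌊ P? ⌋ ≡ false → ¬ P
⌊⌋-false (no ¬p) _ = ¬p

module Count {n t : ℕ} {G : Graph n} (1≤t : 1 ≤ t) (minimal : MinimalWithPivotMinor G (P₃+ t P₁))
             {A : Graph n} {X : Fin n → Bool} (AG : PPT A X G) (C : Copy t A) where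

  open Minimal minimal
  open Leaves AG 1≤t C
  open Positions C

  outside? : Decidable (Outside C)
  outside? v = all? (λ i → ¬? (to C i ≟ v))

  atMiddle? : Decidable (AtMiddle C)
  atMiddle? v = all? (λ x → adj A v (to C x) Bool.≟ δ 1F x)

  inner outer leaves rest : List (Fin n)
  inner  = filter (¬? ∘ outside?) (allFin n)
  outer  = filter outside? (allFin n)
  leaves = filter atMiddle? outer
  rest   = filter (¬? ∘ atMiddle?) outer

  outer-unique : Unique outer
  outer-unique = filter⁺ outside? (allFin⁺ n)

  leaves-unique : Unique leaves
  leaves-unique = filter⁺ atMiddle? outer-unique

  rest-unique : Unique rest
  rest-unique = filter⁺ (¬? ∘ atMiddle?) outer-unique

  ∈leaves⇒Leaf : ∀ {l} → l ∈ leaves → Leaf l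
  ∈leaves⇒Leaf l∈ with l∈outer , lC ← ∈-filter⁻ atMiddle? {xs = outer} l∈ =
    proj₂ (∈-filter⁻ outside? {xs = allFin n} l∈outer) , lC

  ∈rest⇒ : ∀ {w} → w ∈ rest → Outside C w × ¬ AtMiddle C w
  ∈rest⇒ w∈ with w∈outer , ¬wC ← ∈-filter⁻ (¬? ∘ atMiddle?) {xs = outer} w∈ =
    proj₂ (∈-filter⁻ outside? {xs = allFin n} w∈outer) , ¬wC

  n≡sum : n ≡ (length leaves + length rest) + length inner
  n≡sum = begin
    n                                                  ≡⟨ length-tabulate {n = n} id ⟨
    length (allFin n)                                  ≡⟨ length-filter-¬ outside? (allFin n) ⟩
    length outer + length inner                        ≡⟨ cong (_+ length inner) (length-filter-¬ atMiddle? outer) ⟩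
    (length leaves + length rest) + length inner       ∎
    where open ≡-Reasoning

  position : ∀ v → ¬ Outside C v → ∃[ i ] to C i ≡ v
  position v enclosed = decidable-stable (any? (λ i → to C i ≟ v)) (λ none → enclosed (λ i eq → none (i , eq)))

  inner≤ : length inner ≤ 3 + t
  inner≤ = subst (length inner ≤_) (ℕ.*-identityʳ (3 + t))
    (length≤fibres (filter⁺ (¬? ∘ outside?) (allFin⁺ n)) (3 + t) 1 (toℕ ∘ label) (λ _ → toℕ<n _)
      λ g g-inj g∈ const → contradiction (g-inj (begin
        g 0F                   ≡⟨ to-label (g 0F) (enclosed (g∈ 0F)) ⟨
        to C (label (g 0F))    ≡⟨ cong (to C) (toℕ-injective (const 1F)) ⟨
        to C (label (g 1F))    ≡⟨ to-label (g 1F) (enclosed (g∈ 1F)) ⟩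
        g 1F                   ∎)) λ ())
    where
    open ≡-Reasoning
    enclosed : ∀ {v} → v ∈ inner → ¬ Outside C v
    enclosed v∈ = proj₂ (∈-filter⁻ (¬? ∘ outside?) {xs = allFin n} v∈)
    label : Fin n → Fin (3 + t)
    label v with any? (λ i → to C i ≟ v)
    ... | yes (i , _) = i
    ... | no  _       = zero
    to-label : ∀ v → ¬ Outside C v → to C (label v) ≡ v
    to-label v enclosed with any? (λ i → to C i ≟ v)
    ... | yes (i , eq) = eq
    ... | no  none     = contradiction (λ i eq → none (i , eq)) enclosed

  -- Otherwise some nonzero x supported on the leaves has A x = 0 on X.
  leaves≤rest : length leaves ≤ length rest
  leaves≤rest = ℕ.≮⇒≥ λ rest<leaves →
    let x , x-off , (v , xv) , x-killed = dependent (adj A) rest leaves-unique rest<leaves in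
    false≢true (ppt-kernel AG x (row x x-off x-killed v xv) (λ u Xu → x-off u (λ u∈ →
      false≢true Xu (inside-X AG C (proj₁ (∈leaves⇒Leaf u∈))))) v) xv
    where
    open import Data.List.Membership.DecPropositional (_≟_ {n}) using (_∈?_)

    row : ∀ x → (∀ v → ¬ (v ∈ leaves) → x v ≡ false) → (∀ {w} → w ∈ rest → adj A w ∙ x ≡ false) →
          ∀ v → x v ≡ true → ∀ w → X w ≡ true → adj A w ∙ x ≡ false
    row x x-off x-killed v xv w Xw = by-place (outside? w) (atMiddle? w)
      where
      support : ∀ u → x u ≡ true → Leaf u
      support u xu with u ∈? leaves
      ... | yes u∈ = ∈leaves⇒Leaf u∈
      ... | no  u∉ = false≢true (x-off u u∉) xu

      no-leaf-neighbour : (∀ {u} → Leaf u → adj A w u ≡ false) → adj A w ∙ x ≡ false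
      no-leaf-neighbour none = ∙-disjoint (adj A w) x (λ u → zero-term u (x u) refl)
        where
        zero-term : ∀ u k → x u ≡ k → adj A w u ∧ k ≡ false
        zero-term u false _  = ∧-zeroʳ _
        zero-term u true  xu = cong (_∧ true) (none (support u xu))

      -- Among the copy's vertices only `b` is adjacent to leaves. The leaf `v` in the support of
      -- `x` forces `b` out of `X`, so the row of `b` need not be checked.
      b∉X : X b ≡ false
      b∉X = let v∉C , vC = support v xv in
        pendant-at-middle AG C v∉C (λ i → vC (isolated i)) (vC 0F) (vC 1F) (vC 2F)

      not-middle : ∀ i → to C i ≡ w → δ 1F i ≡ false
      not-middle 0F _ = refl
      not-middle 1F refl = false≢true b∉X Xw
      not-middle 2F _ = refl
      not-middle (isolated i) _ = refl

      by-place : Dec (Outside C w) → Dec (AtMiddle C w) → adj A w ∙ x ≡ false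
      by-place (no enclosed) _ with i , refl ← position w enclosed =
        no-leaf-neighbour (λ {u} uL → trans (adj-sym A w u) (trans (proj₂ uL i) (not-middle i refl)))
      by-place (yes w∉C) (yes wC) = no-leaf-neighbour (leaves-nonadjacent (w∉C , wC))
      by-place (yes w∉C) (no ¬wC) =
        x-killed (∈-filter⁺ (¬? ∘ atMiddle?) (∈-filter⁺ outside? (∈-allFin w) w∉C) ¬wC)

  rest≤ : length rest ≤ 2 ^ (3 + t) * t
  rest≤ = length≤fibres rest-unique (2 ^ (3 + t)) t (toℕ ∘ code) (λ _ → toℕ<n _) λ g g-inj g∈ const →
    proj₂ (∈rest⇒ (g∈ zero)) (few-twins AG 1≤t C g g-inj (λ j → proj₁ (∈rest⇒ (g∈ j)))
      (λ j → encode-injective (toℕ-injective (const j))))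
    where
    code : Fin n → Fin (2 ^ (3 + t))
    code v = encode (λ x → adj A v (to C x))

  full? : ∀ w → Dec (All (λ l → adj A w l ≡ true) leaves)
  full? w = All.all? (λ l → adj A w l Bool.≟ true) leaves

  -- Since leaves can replace `a` and `c`, the two bits recording adjacency to these give way to a
  -- single bit, adjacency to all leaves.
  many-leaves⇒rest≤ : 2 + suc t * t ≤ length leaves → length rest ≤ 2 ^ (2 + t) * t
  many-leaves⇒rest≤ many = length≤fibres rest-unique (2 ^ (2 + t)) t (toℕ ∘ encode ∘ bits) (λ _ → toℕ<n _)
    λ g g-inj g∈ const → contradict g g-inj g∈ (λ j → encode-injective (toℕ-injective (const j))) _ refl
    where
    bits : Fin n → Fin (2 + t) → Bool
    bits v zero          = ⌊ full? v ⌋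
    bits v (suc zero)    = adj A v b
    bits v (suc (suc i)) = adj A v (I i)

    contradict : ∀ g → Injective _≡_ _≡_ g → (∀ i → g i ∈ rest) → (∀ j i → bits (g j) i ≡ bits (g zero) i) →
                 ∀ f → ⌊ full? (g zero) ⌋ ≡ f → ⊥
    contradict g g-inj g∈ same true full = not-all-full leaves-unique ∈leaves⇒Leaf many g g-inj
      (λ j → proj₁ (∈rest⇒ (g∈ j))) (λ j → proj₂ (∈rest⇒ (g∈ j)))
      (λ j → same j 1F) (λ j i → same j (suc (suc i)))
      (λ j l∈ → All.lookup (⌊⌋-true (full? (g j)) (trans (same j 0F) full)) l∈)
    contradict g g-inj g∈ same false nonfull = not-all-nonfull leaves-unique ∈leaves⇒Leaf many g g-inj
      (λ j → proj₁ (∈rest⇒ (g∈ j))) (λ j → proj₂ (∈rest⇒ (g∈ j)))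
      (λ j → same j 1F) (λ j i → same j (suc (suc i)))
      missed
      where
      missed : ∀ j → ∃[ l ] (l ∈ leaves × adj A (g j) l ≡ false)
      missed j with l , l∈ , ¬wl ← find (¬All⇒Any¬ (λ l → adj A (g j) l Bool.≟ true) leaves
                                     (⌊⌋-false (full? (g j)) (trans (same j 0F) nonfull))) =
        l , l∈ , ¬-not ¬wl

  order≤ : n ≤ (1 + suc t * t) + 2 ^ (3 + t) * t + (3 + t)
  order≤ = subst (_≤ _) (sym n≡sum) (ℕ.+-mono-≤ outer≤ inner≤)
    where
    open ℕ.≤-Reasoning
    outer≤ : length leaves + length rest ≤ (1 + suc t * t) + 2 ^ (3 + t) * t
    outer≤ with 2 + suc t * t ℕ.≤? length leaves
    ... | no  few  = ℕ.+-mono-≤ (ℕ.<⇒≤pred (ℕ.≰⇒> few)) rest≤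
    ... | yes many = begin
      length leaves + length rest              ≤⟨ ℕ.+-monoˡ-≤ (length rest) leaves≤rest ⟩
      length rest + length rest                ≤⟨ ℕ.+-mono-≤ (many-leaves⇒rest≤ many) (many-leaves⇒rest≤ many) ⟩
      2 ^ (2 + t) * t + 2 ^ (2 + t) * t        ≡⟨ double (2 ^ (2 + t)) t ⟩
      2 ^ (3 + t) * t                          ≤⟨ ℕ.m≤n+m _ _ ⟩
      (1 + suc t * t) + 2 ^ (3 + t) * t        ∎
      where
      double : ∀ p t → p * t + p * t ≡ 2 * p * t
      double = solve-∀

-- With `t = suc s`, this is the inequality that `order≤⇒bound` reduces to; for `s = 0` it reads 15
-- ≤ 16.
quadratic≤2^ : ∀ s → 2 * (s * s) + 11 * s + 15 ≤ 2 ^ (4 + s)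
quadratic≤2^ zero    = ℕ.m≤m+n 15 1
quadratic≤2^ (suc s) = begin
  2 * (suc s * suc s) + 11 * suc s + 15           ≤⟨ ℕ.m≤m+n _ (2 * (s * s) + 7 * s + 2) ⟩
  2 * (suc s * suc s) + 11 * suc s + 15 + (2 * (s * s) + 7 * s + 2)  ≡⟨ regroup s ⟩
  2 * (2 * (s * s) + 11 * s + 15)                 ≤⟨ ℕ.*-monoʳ-≤ 2 (quadratic≤2^ s) ⟩
  2 ^ (4 + suc s)                                 ∎
  where
  open ℕ.≤-Reasoning
  regroup : ∀ s → 2 * (suc s * suc s) + 11 * suc s + 15 + (2 * (s * s) + 7 * s + 2) ≡
                  2 * (2 * (s * s) + 11 * s + 15)
  regroup = solve-∀

-- Substituting 2^(t + 3) = D + (t + 4) gives t D plus a quadratic plus 2 on the left, so the claim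
-- is that the quadratic fits into one further D. The same estimate shows that the subtraction is
-- not truncated.
order≤⇒bound : ∀ t → 1 ≤ t →
               (1 + suc t * t) + 2 ^ (3 + t) * t + (3 + t) ≤ (t + 1) * (2 ^ (t + 3) ∸ t ∸ 4) + 2
order≤⇒bound (suc s) _ rewrite ℕ.+-comm s 3 | ℕ.∸-+-assoc (2 ^ (4 + s)) (suc s) 4 = begin
  (1 + suc (suc s) * suc s) + 2 ^ (4 + s) * suc s + (4 + s)
    ≡⟨ cong (λ e → (1 + suc (suc s) * suc s) + e * suc s + (4 + s)) E≡ ⟩
  (1 + suc (suc s) * suc s) + (D + (suc s + 4)) * suc s + (4 + s)
    ≡⟨ collect s D ⟩
  suc s * D + (2 * (s * s) + 10 * s + 10) + 2                              ≤⟨ ℕ.+-monoˡ-≤ 2 (ℕ.+-monoʳ-≤ (suc s * D) q≤D) ⟩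
  suc s * D + D + 2                                                        ≡⟨ factor s D ⟩
  (suc s + 1) * D + 2                                                      ∎
  where
  open ℕ.≤-Reasoning
  D : ℕ
  D = 2 ^ (4 + s) ∸ (suc s + 4)
  regroup : ∀ s → 2 * (s * s) + 11 * s + 15 ≡ (2 * (s * s) + 10 * s + 10) + (suc s + 4)
  regroup = solve-∀
  collect : ∀ s D → (1 + suc (suc s) * suc s) + (D + (suc s + 4)) * suc s + (4 + s) ≡
                    suc s * D + (2 * (s * s) + 10 * s + 10) + 2
  collect = solve-∀
  factor : ∀ s D → suc s * D + D + 2 ≡ (suc s + 1) * D + 2
  factor = solve-∀
  q≤ : (2 * (s * s) + 10 * s + 10) + (suc s + 4) ≤ 2 ^ (4 + s)
  q≤ = subst (_≤ 2 ^ (4 + s)) (regroup s) (quadratic≤2^ s)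
  q≤D : 2 * (s * s) + 10 * s + 10 ≤ D
  q≤D = ℕ.m+n≤o⇒m≤o∸n _ q≤
  E≡ : 2 ^ (4 + s) ≡ D + (suc s + 4)
  E≡ = sym (ℕ.m∸n+n≡m (ℕ.m+n≤o⇒n≤o (2 * (s * s) + 10 * s + 10) q≤))

theorem4p16 : ∀ (t : ℕ) → 1 ≤ t → ∀ {n : ℕ} (G : Graph n) →
    MinimalWithPivotMinor G (P₃+ t P₁) →
    n ≤ (t + 1) * (2 ^ (t + 3) ∸ t ∸ 4) + 2
theorem4p16 t 1≤t G minimal with A , X , AG , C ← minimal⇒ppt minimal =
  ℕ.≤-trans (Count.order≤ 1≤t minimal AG C) (order≤⇒bound t 1≤t)
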